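{- Let $q=p^r$ with $p$ prime, $p\ne 2$, $p\ne 3$. Let $$f_2(x_1,x_2)=t\bigl(x_1^{q-2}+x_2^{q-2}\bigr).$$ Then the polynomial $t\bigl(f_2(x_1,x_2)+x_3^{q-2}\bigr)\in\mathbb{F}_q[x_1,x_2,x_3]$, reduced modulo $x_j^q-x_j$, has degree $3(q-2)$.
   Context: $\mathbb{F}_q$ is the finite field with $q$ elements, and $$t(x)=x+\sum_{k=0}^{q-2}x^k\in\mathbb{F}_q[x];$$ this polynomial swaps $0$ and $1$ and fixes every other element. Degree means the total degree of the reduced representative (degree $<q$ in each variable). -}

module Defs where

open import Algebra.Bundles using (CommutativeRing)
open import Data.Bool.Base using (if_then_else_)
open import Data.Fin.Base using (Fin; zero)
open import Data.Fin.Patterns using (0F; 1F; 2F)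
open import Data.List.Base using (List; []; _∷_; _++_; map; foldr; concatMap; cartesianProductWith; upTo; allFin)
open import Data.Nat.Base as ℕ using (ℕ; zero; suc; _∸_)
import Data.Nat.Properties as ℕₚ
open import Data.Product.Base using (Σ; ∃; _×_; _,_)
open import Data.Vec.Base as Vec using (Vec; lookup; replicate; zipWith; _[_]≔_)
import Data.Vec.Properties as Vecₚ
open import Function.Bundles using (Inverse)
open import Level using (Level; _⊔_) renaming (suc to lsuc)
open import Relation.Binary.PropositionalEquality using (_≡_)
import Relation.Binary.PropositionalEquality as ≡
open import Relation.Nullary using (¬_; does)

record FiniteField (c ℓ : Level) (q : ℕ) : Set (lsuc (c ⊔ ℓ)) where
  field
    commutativeRing : CommutativeRing c ℓ
  open CommutativeRing commutativeRing public
  field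
    0≉1         : ¬ 0# ≈ 1#
    inverse     : ∀ x → ¬ x ≈ 0# → ∃ λ y → x * y ≈ 1#
    enumeration : Inverse setoid (≡.setoid (Fin q))

module Polynomials {c ℓ : Level} (R : CommutativeRing c ℓ) where
  open CommutativeRing R using (Carrier; _≈_; _+_; _*_; -_; 0#; 1#)

  infix  4 _≋_
  infixl 6 _⊕_ _⊖_
  infixl 7 _⊗_
  infixr 8 _^^_

  Exponent : ℕ → Set
  Exponent n = Vec ℕ n

  -- A polynomial in n variables is a formal finite sum of terms (a , e),
  -- meaning a·x₁^e₁⋯xₙ^eₙ.  Repeated exponents and zero coefficients are
  -- allowed; only the collected coefficients below are meaningful.
  Poly : ℕ → Set c
  Poly n = List (Carrier × Exponent n)

  coeff : ∀ {n} → Poly n → Exponent n → Carrier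
  coeff []            e = 0#
  coeff ((a , d) ∷ P) e = (if does (Vecₚ.≡-dec ℕₚ._≟_ d e) then a else 0#) + coeff P e

  _≋_ : ∀ {n} → Poly n → Poly n → Set ℓ
  P ≋ Q = ∀ e → coeff P e ≈ coeff Q e

  const : ∀ {n} → Carrier → Poly n
  const {n} a = (a , replicate n 0) ∷ []

  X : ∀ {n} → Fin n → Poly n
  X {n} i = (1# , replicate n 0 [ i ]≔ 1) ∷ []

  _⊕_ : ∀ {n} → Poly n → Poly n → Poly n
  P ⊕ Q = P ++ Q

  _⊗_ : ∀ {n} → Poly n → Poly n → Poly n
  _⊗_ = cartesianProductWith λ (a , d) (b , e) → a * b , zipWith ℕ._+_ d e

  _⊖_ : ∀ {n} → Poly n → Poly n → Poly n
  P ⊖ Q = P ⊕ map (λ (b , e) → - b , e) Q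

  _^^_ : ∀ {n} → Poly n → ℕ → Poly n
  P ^^ zero  = const 1#
  P ^^ suc k = P ⊗ (P ^^ k)

  ∑ : ∀ {n} → List (Poly n) → Poly n
  ∑ = foldr _⊕_ []

  ∏ : ∀ {n} → List (Poly n) → Poly n
  ∏ = foldr _⊗_ (const 1#)

  -- P ⟦ σ ⟧ is P(σ₁, …, σₘ).
  _⟦_⟧ : ∀ {m n} → Poly m → (Fin m → Poly n) → Poly n
  _⟦_⟧ {m} P σ = concatMap (λ (a , e) → const a ⊗ ∏ (map (λ i → σ i ^^ lookup e i) (allFin m))) P

  HasTotalDegree : ∀ {n} → Poly n → ℕ → Set ℓ
  HasTotalDegree P d =
    (∃ λ e → Vec.sum e ≡ d × ¬ coeff P e ≈ 0#) ×
    (∀ e → d ℕ.< Vec.sum e → coeff P e ≈ 0#)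

  -- Degree < q in each variable.
  IsReduced : ∀ {n} → ℕ → Poly n → Set ℓ
  IsReduced q P = ∀ e i → q ℕ.≤ lookup e i → coeff P e ≈ 0#

  -- Congruence modulo the ideal generated by all x_j^q − x_j.
  CongruentMod : ∀ {n} → ℕ → Poly n → Poly n → Set (c ⊔ ℓ)
  CongruentMod {n} q P Q =
    Σ (Fin n → Poly n) λ A →
      P ⊖ Q ≋ ∑ (map (λ j → A j ⊗ (X j ^^ q ⊖ X j)) (allFin n))

  IsReducedRepresentative : ∀ {n} → ℕ → Poly n → Poly n → Set (c ⊔ ℓ)
  IsReducedRepresentative q P R = IsReduced q R × CongruentMod q P R

  -- A reduced representative of P exists, and every one (it is unique up to
  -- ≋) has total degree d.
  HasReducedDegree : ∀ {n} → ℕ → Poly n → ℕ → Set (c ⊔ ℓ)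
  HasReducedDegree q P d =
    (∃ λ R → IsReducedRepresentative q P R) ×
    (∀ R → IsReducedRepresentative q P R → HasTotalDegree R d)

module Transposition {c ℓ : Level} {q : ℕ} (F : FiniteField c ℓ q) where
  open Polynomials (FiniteField.commutativeRing F) public

  -- upTo (q ∸ 1) lists k = 0, …, q − 2.
  t : Poly 1
  t = X zero ⊕ ∑ (map (X zero ^^_) (upTo (q ∸ 1)))

  t⟨_⟩ : ∀ {n} → Poly n → Poly n
  t⟨ P ⟩ = t ⟦ (λ _ → P) ⟧

  x₁ x₂ x₃ : Poly 3
  x₁ = X 0F
  x₂ = X 1F
  x₃ = X 2F

  -- Taken in F[x₁,x₂,x₃] ⊇ F[x₁,x₂].
  f₂ : Poly 3
  f₂ = t⟨ x₁ ^^ (q ∸ 2) ⊕ x₂ ^^ (q ∸ 2) ⟩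

{-# OPTIONS --safe #-}

-- As a function, t is y ↦ y + [y = 0] − [y = 1].  For a reduced polynomial R in three variables the
-- coefficient of x^e, where e = (q−1,q−1,q−1) − d with all d_i < q−1, is −Σ R(x) x^d over all points,
-- because Σ x^k = 0 for k < 2(q−1), k ≠ q−1, and Σ x^(q−1) = −1.  After the substitution x ↦ x^(q−2)
-- in each variable this moment of t(f₂ + x₃^(q−2)) becomes
--   Σ t(t(u + v) + w) u^(−d₁) v^(−d₂) w^(−d₃)   (with 0^(−1) = 0).
-- If some d_i = 0, translating one variable splits off a factor Σ t(w) = 0 or Σ u^(−d) = 0; this covers
-- every exponent of total degree > 3(q−2).  For d = (1,1,1) the sum over w is −1 − 1/s + 1/(s−1) with
-- s = u + v, the sum of 1/(uv) over u + v = s is −2/s², and Σ 1/(s²(s−1)) = 3, so that the moment is −6,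
-- which is nonzero as q is prime to 6.
module Submission where

open import Defs
open import Algebra.Bundles using (CommutativeMonoid; CommutativeRing)
open import Algebra.Definitions using (Congruent₁)
open import Algebra.Solver.Ring.AlmostCommutativeRing using (_-Raw-AlmostCommutative⟶_; fromCommutativeRing)
open import Data.Bool.Base using (true; false; if_then_else_)
open import Data.Fin.Base using (Fin; zero; suc; punchIn; inject≤)
open import Data.Fin.Patterns using (0F; 1F; 2F)
open import Data.Fin.Permutation using (Permutation; permutation)
import Data.Fin.Properties as Finₚ
open import Data.Integer.Base as ℤ using (ℤ; 0ℤ; 1ℤ)
import Data.Integer.Properties as ℤₚ
open import Data.List.Base as List using ([]; _∷_; _++_; map; length; allFin; applyUpTo)
import Data.List.Properties as Listₚ
open import Data.Maybe.Base using (Maybe; just; nothing)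
open import Data.Nat.Base as ℕ using (ℕ; zero; suc; z≤n; s≤s; z<s)
open import Data.Nat.Coprimality using (Coprime; coprime-Bézout)
open import Data.Nat.Divisibility using (_∣_; divides; ∣-trans; ∣⇒≤; _∣?_; ∣1⇒≡1)
open import Data.Nat.GCD using (module Bézout)
open import Data.Nat.Induction using (<-wellFounded)
open import Data.Nat.Primality using (Prime; prime?; euclidsLemma; prime⇒irreducible)
import Data.Nat.Properties as ℕₚ
open import Data.Nat.Solver using (module +-*-Solver)
open import Data.Product.Base using (∃; _×_; _,_; proj₁; proj₂)
import Data.Sign.Base as Sign
open import Data.Sum.Base using (_⊎_; inj₁; inj₂)
open import Data.Vec.Base as Vec using (Vec; []; _∷_; lookup; replicate; zipWith; _[_]≔_)
import Data.Vec.Properties as Vecₚ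
open import Function.Base using (_∘_)
open import Function.Bundles using (Inverse)
open import Induction.WellFounded using (Acc; acc)
open import Level using (Level; _⊔_)
open import Relation.Binary.Definitions using (Decidable; tri<; tri≈; tri>)
open import Relation.Binary.PropositionalEquality as ≡ using (_≡_; _≢_)
open import Relation.Nullary using (¬_; yes; no; does; contradiction)
open import Relation.Nullary.Decidable using (from-yes; from-no)

-- The constants -2 and 3 come entirely from the convention 0^(-1) = 0. Away from the poles
-- 1/(u(s-u)) and 1/(s²(s-1)) equal their partial fractions, and each partial fraction sums to 0
-- over the field. What survives is the corrections at the poles: -1/s² at each of u = 0 and u = s,
-- then 1 at s = 0 and 2 at s = 1. The inner t leaves no trace in the moment for (1,1,1): the
-- function of t(s) that results from the sum over w takes the value -2 at both 0 and 1, the two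
-- points that t swaps. That q is prime to 6 enters twice: 6 is nonzero in the field, and q is at
-- least 5, so that Σ 1/s³ is a power sum with exponent below q-1 and vanishes. Polynomials are
-- uncollected lists of terms, so a reduced one may still list large exponents whose coefficients
-- cancel; moments are therefore compared through collected coefficients and never term by term.

-- Integer constants for the ring solver over an arbitrary commutative ring.

module IntegerCoefficients {c ℓ : Level} (R : CommutativeRing c ℓ) where
  open CommutativeRing R
  open import Algebra.Properties.Ring ring
  open import Algebra.Properties.AbelianGroup +-abelianGroup using (⁻¹-∙-comm)
  open import Algebra.Properties.Group +-group using (ε⁻¹≈ε; ⁻¹-involutive)
  open import Algebra.Properties.Semiring.Mult.TCOptimised semiring using (1+×; ×-homo-+; ×1-homo-*) renaming (_×_ to _ᴺ×_)
  open import Relation.Binary.Reasoning.Setoid setoid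

  -- With the optimised multiples `1 ᴺ× 1#` computes to `1#`, so `con 1ℤ` and `con 0ℤ` denote `1#`
  -- and `0#` definitionally in every solver call.
  fromℤ : ℤ → Carrier
  fromℤ (ℤ.+ n)    = n ᴺ× 1#
  fromℤ ℤ.-[1+ n ] = - (suc n ᴺ× 1#)

  fromℤ-neg : ∀ i → fromℤ (ℤ.- i) ≈ - fromℤ i
  fromℤ-neg (ℤ.+ zero)  = sym ε⁻¹≈ε
  fromℤ-neg (ℤ.+ suc n) = refl
  fromℤ-neg ℤ.-[1+ n ]  = sym (⁻¹-involutive _)

  fromℤ-⊖ : ∀ m n → fromℤ (m ℤ.⊖ n) ≈ m ᴺ× 1# - n ᴺ× 1#
  fromℤ-⊖ m       zero    = sym (trans (+-congˡ ε⁻¹≈ε) (+-identityʳ _))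
  fromℤ-⊖ zero    (suc n) = sym (+-identityˡ _)
  fromℤ-⊖ (suc m) (suc n) = begin
    fromℤ (suc m ℤ.⊖ suc n)                ≡⟨ ≡.cong fromℤ (ℤₚ.[1+m]⊖[1+n]≡m⊖n m n) ⟩
    fromℤ (m ℤ.⊖ n)                        ≈⟨ fromℤ-⊖ m n ⟩
    -- A term 1 - 1 is inserted, and its halves are absorbed by the two multiples.
    m ᴺ× 1# - n ᴺ× 1#                        ≈⟨ +-congʳ (+-identityʳ _) ⟨
    m ᴺ× 1# + 0# - n ᴺ× 1#                   ≈⟨ +-congʳ (+-congˡ (-‿inverseʳ 1#)) ⟨
    m ᴺ× 1# + (1# - 1#) - n ᴺ× 1#            ≈⟨ +-congʳ (+-assoc _ _ _) ⟨
    m ᴺ× 1# + 1# - 1# - n ᴺ× 1#              ≈⟨ +-assoc _ _ _ ⟩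
    m ᴺ× 1# + 1# + (- 1# - n ᴺ× 1#)          ≈⟨ +-cong (+-comm _ _) (⁻¹-∙-comm 1# (n ᴺ× 1#)) ⟩
    1# + m ᴺ× 1# - (1# + n ᴺ× 1#)            ≈⟨ +-cong (1+× m 1#) (-‿cong (1+× n 1#)) ⟨
    suc m ᴺ× 1# - suc n ᴺ× 1#                ∎

  fromℤ-+ : ∀ i j → fromℤ (i ℤ.+ j) ≈ fromℤ i + fromℤ j
  fromℤ-+ (ℤ.+ m)    (ℤ.+ n)    = ×-homo-+ 1# m n
  fromℤ-+ (ℤ.+ m)    ℤ.-[1+ n ] = fromℤ-⊖ m (suc n)
  fromℤ-+ ℤ.-[1+ m ] (ℤ.+ n)    = trans (fromℤ-⊖ n (suc m)) (+-comm _ _)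
  fromℤ-+ ℤ.-[1+ m ] ℤ.-[1+ n ] = begin
    - (suc (suc (m ℕ.+ n)) ᴺ× 1#)     ≡⟨ ≡.cong (λ k → - (suc k ᴺ× 1#)) (ℕₚ.+-suc m n) ⟨
    - ((suc m ℕ.+ suc n) ᴺ× 1#)       ≈⟨ -‿cong (×-homo-+ 1# (suc m) (suc n)) ⟩
    - (suc m ᴺ× 1# + suc n ᴺ× 1#)      ≈⟨ ⁻¹-∙-comm _ _ ⟨
    - (suc m ᴺ× 1#) - suc n ᴺ× 1#      ∎

  fromℤ-* : ∀ i j → fromℤ (i ℤ.* j) ≈ fromℤ i * fromℤ j
  fromℤ-* (ℤ.+ m)    (ℤ.+ n)    = begin
    fromℤ (Sign.+ ℤ.◃ m ℕ.* n)   ≡⟨ ≡.cong fromℤ (ℤₚ.+◃n≡+n (m ℕ.* n)) ⟩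
    (m ℕ.* n) ᴺ× 1#               ≈⟨ ×1-homo-* m n ⟩
    m ᴺ× 1# * (n ᴺ× 1#)            ∎
  fromℤ-* (ℤ.+ m)    ℤ.-[1+ n ] = begin
    fromℤ (Sign.- ℤ.◃ m ℕ.* suc n) ≡⟨ ≡.cong fromℤ (ℤₚ.-◃n≡-n (m ℕ.* suc n)) ⟩
    fromℤ (ℤ.- (ℤ.+ (m ℕ.* suc n)))    ≈⟨ fromℤ-neg (ℤ.+ (m ℕ.* suc n)) ⟩
    - ((m ℕ.* suc n) ᴺ× 1#)         ≈⟨ -‿cong (×1-homo-* m (suc n)) ⟩
    - (m ᴺ× 1# * (suc n ᴺ× 1#))      ≈⟨ -‿distribʳ-* _ _ ⟩
    m ᴺ× 1# * - (suc n ᴺ× 1#)        ∎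
  fromℤ-* ℤ.-[1+ m ] (ℤ.+ n)    = begin
    fromℤ (Sign.- ℤ.◃ suc m ℕ.* n) ≡⟨ ≡.cong fromℤ (ℤₚ.-◃n≡-n (suc m ℕ.* n)) ⟩
    fromℤ (ℤ.- (ℤ.+ (suc m ℕ.* n)))    ≈⟨ fromℤ-neg (ℤ.+ (suc m ℕ.* n)) ⟩
    - ((suc m ℕ.* n) ᴺ× 1#)         ≈⟨ -‿cong (×1-homo-* (suc m) n) ⟩
    - (suc m ᴺ× 1# * (n ᴺ× 1#))      ≈⟨ -‿distribˡ-* _ _ ⟩
    - (suc m ᴺ× 1#) * (n ᴺ× 1#)      ∎
  fromℤ-* ℤ.-[1+ m ] ℤ.-[1+ n ] = begin
    (suc m ℕ.* suc n) ᴺ× 1#              ≈⟨ ×1-homo-* (suc m) (suc n) ⟩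
    suc m ᴺ× 1# * (suc n ᴺ× 1#)           ≈⟨ ⁻¹-involutive _ ⟨
    - - (suc m ᴺ× 1# * (suc n ᴺ× 1#))     ≈⟨ -‿cong (-‿distribˡ-* _ _) ⟩
    - (- (suc m ᴺ× 1#) * (suc n ᴺ× 1#))   ≈⟨ -‿distribʳ-* _ _ ⟩
    - (suc m ᴺ× 1#) * - (suc n ᴺ× 1#)     ∎

  morphism : ℤ.+-*-rawRing -Raw-AlmostCommutative⟶ fromCommutativeRing R
  morphism = record
    { ⟦_⟧    = fromℤ
    ; +-homo = fromℤ-+
    ; *-homo = fromℤ-*
    ; -‿homo = fromℤ-neg
    ; 0-homo = refl
    ; 1-homo = refl
    }

  -- A sufficient test is all that the solver asks for. Distinct integers can have equal images in
  -- positive characteristic, so a failed comparison claims nothing.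
  fromℤ-≟ : ∀ i j → Maybe (fromℤ i ≈ fromℤ j)
  fromℤ-≟ i j with i ℤₚ.≟ j
  ... | yes i≡j = just (reflexive (≡.cong fromℤ i≡j))
  ... | no _    = nothing

  open import Algebra.Solver.Ring ℤ.+-*-rawRing (fromCommutativeRing R) morphism fromℤ-≟ public

-- Finite sums with at most one nontrivial term.

module SingleSupport {c ℓ : Level} (M : CommutativeMonoid c ℓ) where
  open CommutativeMonoid M
  open import Algebra.Properties.CommutativeMonoid.Sum M

  sum-zero : ∀ {n} {f : Fin n → Carrier} → (∀ i → f i ≈ ε) → sum f ≈ ε
  sum-zero {n} f≈ε = trans (sum-cong-≋ f≈ε) (sum-replicate-zero n)

  sum-single : ∀ {n} (f : Fin n → Carrier) i → (∀ j → j ≢ i → f j ≈ ε) → sum f ≈ f i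
  sum-single {suc n} f i f≈ε =
    trans (sum-remove {i = i} f)
      (trans (∙-congˡ (sum-zero λ j → f≈ε (punchIn i j) (Finₚ.punchInᵢ≢i i j)))
             (identityʳ (f i)))

-- Fields with q = n + 2 elements; q - 1 and q - 2 are then `suc n` and `n`, without truncated
-- subtraction.

module FiniteFieldTheory {c ℓ : Level} {n : ℕ} (F : FiniteField c ℓ (suc (suc n))) where
  open FiniteField F hiding (zero)
  open IntegerCoefficients commutativeRing using (solve; _:=_; _:+_; _:*_; _:-_; :-_; con)
  open import Algebra.Properties.CommutativeSemiring.Exp commutativeSemiring using (_^_; ^-congˡ; ^-distrib-*; ^-homo-*)
  open import Algebra.Properties.Semiring.Sum semiring
  open import Algebra.Properties.Semiring.Mult semiring using () renaming (_×_ to _ᴺ×_)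
  open import Algebra.Properties.Group +-group using (∙-cancelˡ; x≈y⇒x∙y⁻¹≈ε; x∙y⁻¹≈ε⇒x≈y)
  import Algebra.Properties.CommutativeMonoid.Sum *-commutativeMonoid as ∏
  open SingleSupport +-commutativeMonoid
  open import Relation.Binary.Reasoning.Setoid setoid

  q : ℕ
  q = suc (suc n)

  enum : Fin q → Carrier
  enum = Inverse.from enumeration

  index : Carrier → Fin q
  index = Inverse.to enumeration

  index-cong : ∀ {x y} → x ≈ y → index x ≡ index y
  index-cong = Inverse.to-cong enumeration

  enum-index : ∀ x → enum (index x) ≈ x
  enum-index = Inverse.strictlyInverseʳ enumeration

  index-enum : ∀ i → index (enum i) ≡ i
  index-enum = Inverse.strictlyInverseˡ enumeration

  enum-injective : ∀ {i j} → enum i ≈ enum j → i ≡ j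
  enum-injective {i} {j} eq = ≡.trans (≡.sym (index-enum i)) (≡.trans (index-cong eq) (index-enum j))

  infix 4 _≟_
  _≟_ : Decidable _≈_
  x ≟ y with index x Finₚ.≟ index y
  ... | yes eq = yes (trans (sym (enum-index x)) (trans (reflexive (≡.cong enum eq)) (enum-index y)))
  ... | no neq = no (neq ∘ index-cong)

  *-cancelˡ-0 : ∀ {x y} → ¬ x ≈ 0# → x * y ≈ 0# → y ≈ 0#
  *-cancelˡ-0 {x} {y} x≉0 xy≈0 with inverse x x≉0
  ... | x′ , xx′≈1 = begin
    y              ≈⟨ *-identityˡ y ⟨
    1# * y         ≈⟨ *-congʳ xx′≈1 ⟨
    x * x′ * y     ≈⟨ solve 3 (λ a b c → a :* b :* c := b :* (a :* c)) refl x x′ y ⟩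
    x′ * (x * y)   ≈⟨ *-congˡ xy≈0 ⟩
    x′ * 0#        ≈⟨ zeroʳ x′ ⟩
    0#             ∎

  *-≉0 : ∀ {x y} → ¬ x ≈ 0# → ¬ y ≈ 0# → ¬ x * y ≈ 0#
  *-≉0 x≉0 y≉0 = y≉0 ∘ *-cancelˡ-0 x≉0

  *-cancelˡ-1 : ∀ {x y} → ¬ x ≈ 0# → x * y ≈ x → y ≈ 1#
  *-cancelˡ-1 {x} {y} x≉0 xy≈x = x∙y⁻¹≈ε⇒x≈y y 1# (*-cancelˡ-0 x≉0 (begin
    x * (y - 1#)   ≈⟨ solve 2 (λ x y → x :* (y :- con 1ℤ) := x :* y :- x) refl x y ⟩
    x * y - x      ≈⟨ x≈y⇒x∙y⁻¹≈ε xy≈x ⟩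
    0#             ∎))

  -- Sums over the whole field

  -- abstract keeps conversion checking from unfolding sums over Fin (suc (suc n)).
  abstract
    Σᶠ : (Carrier → Carrier) → Carrier
    Σᶠ f = sum (f ∘ enum)

    Σᶠ-cong : ∀ {f g} → (∀ x → f x ≈ g x) → Σᶠ f ≈ Σᶠ g
    Σᶠ-cong f≈g = sum-cong-≋ (f≈g ∘ enum)

    Σᶠ-+ : ∀ f g → Σᶠ (λ x → f x + g x) ≈ Σᶠ f + Σᶠ g
    Σᶠ-+ f g = ∑-distrib-+ (f ∘ enum) (g ∘ enum)

    Σᶠ-*ˡ : ∀ a f → Σᶠ (λ x → a * f x) ≈ a * Σᶠ f
    Σᶠ-*ˡ a f = sym (*-distribˡ-sum a (f ∘ enum))

    Σᶠ-*ʳ : ∀ a f → Σᶠ (λ x → f x * a) ≈ Σᶠ f * a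
    Σᶠ-*ʳ a f = sym (*-distribʳ-sum a (f ∘ enum))

    Σᶠ-neg : ∀ f → Σᶠ (λ x → - f x) ≈ - Σᶠ f
    Σᶠ-neg f = begin
      Σᶠ (λ x → - f x)        ≈⟨ Σᶠ-cong (λ x → neg (f x)) ⟩
      Σᶠ (λ x → - 1# * f x)   ≈⟨ Σᶠ-*ˡ (- 1#) f ⟩
      - 1# * Σᶠ f             ≈⟨ neg (Σᶠ f) ⟨
      - Σᶠ f                  ∎
      where
      neg : ∀ x → - x ≈ - 1# * x
      neg = solve 1 (λ x → :- x := :- con 1ℤ :* x) refl

    Σᶠ-comm : ∀ (f : Carrier → Carrier → Carrier) → Σᶠ (λ x → Σᶠ (f x)) ≈ Σᶠ (λ y → Σᶠ (λ x → f x y))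
    Σᶠ-comm f = ∑-comm (λ i j → f (enum i) (enum j))

    Σᶠ-zero : ∀ {f} → (∀ x → f x ≈ 0#) → Σᶠ f ≈ 0#
    Σᶠ-zero f≈0 = sum-zero (f≈0 ∘ enum)

    Σᶠ-const : ∀ a → Σᶠ (λ _ → a) ≈ q ᴺ× a
    Σᶠ-const a = sum-replicate q

  -- The two maps are inverse only up to `≈`; conjugation with the enumeration turns them into a
  -- genuine permutation of indices, under which finite sums are invariant.
  record Bijection : Set (c Level.⊔ ℓ) where
    field
      to from   : Carrier → Carrier
      to-cong   : Congruent₁ _≈_ to
      from-cong : Congruent₁ _≈_ from
      to-from   : ∀ x → to (from x) ≈ x
      from-to   : ∀ x → from (to x) ≈ x

    onIndices : Permutation q q
    onIndices = permutation (index ∘ to ∘ enum) (index ∘ from ∘ enum)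
      (λ i → ≡.trans (index-cong (trans (to-cong (enum-index _)) (to-from _))) (index-enum i))
      (λ i → ≡.trans (index-cong (trans (from-cong (enum-index _)) (from-to _))) (index-enum i))

  translation : Carrier → Bijection
  translation a = record
    { to        = a +_
    ; from      = - a +_
    ; to-cong   = +-congˡ
    ; from-cong = +-congˡ
    ; to-from   = solve 2 (λ a x → a :+ (:- a :+ x) := x) refl a
    ; from-to   = solve 2 (λ a x → :- a :+ (a :+ x) := x) refl a
    }

  reflection : Carrier → Bijection
  reflection a = record
    { to        = λ x → a - x
    ; from      = λ x → a - x
    ; to-cong   = +-congˡ ∘ -‿cong
    ; from-cong = +-congˡ ∘ -‿cong
    ; to-from   = solve 2 (λ a x → a :- (a :- x) := x) refl a
    ; from-to   = solve 2 (λ a x → a :- (a :- x) := x) refl a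
    }

  scaling : ∀ a → ¬ a ≈ 0# → Bijection
  scaling a a≉0 with inverse a a≉0
  ... | b , ab≈1 = record
    { to        = a *_
    ; from      = b *_
    ; to-cong   = *-congˡ
    ; from-cong = *-congˡ
    ; to-from   = λ x → trans (sym (*-assoc a b x)) (trans (*-congʳ ab≈1) (*-identityˡ x))
    ; from-to   = λ x → trans (sym (*-assoc b a x)) (trans (*-congʳ (trans (*-comm b a) ab≈1)) (*-identityˡ x))
    }

  abstract
    Σᶠ-bijection : ∀ {f} → Congruent₁ _≈_ f → (φ : Bijection) → Σᶠ (f ∘ Bijection.to φ) ≈ Σᶠ f
    Σᶠ-bijection {f} f-cong φ = begin
      Σᶠ (f ∘ to)                              ≈⟨ sum-cong-≋ (λ i → f-cong (sym (enum-index (to (enum i))))) ⟩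
      sum (f ∘ enum ∘ index ∘ to ∘ enum)       ≈⟨ sum-permute (f ∘ enum) onIndices ⟨
      Σᶠ f                                     ∎
      where open Bijection φ

  δ : Carrier → Carrier → Carrier
  δ a x = if does (a ≟ x) then 1# else 0#

  δ-≈ : ∀ {a x} → a ≈ x → δ a x ≈ 1#
  δ-≈ {a} {x} a≈x with a ≟ x
  ... | yes _  = refl
  ... | no a≉x = contradiction a≈x a≉x

  δ-≉ : ∀ {a x} → ¬ a ≈ x → δ a x ≈ 0#
  δ-≉ {a} {x} a≉x with a ≟ x
  ... | yes a≈x = contradiction a≈x a≉x
  ... | no _    = refl

  abstract
    Σᶠ-δ : ∀ {f} → Congruent₁ _≈_ f → ∀ a → Σᶠ (λ x → δ a x * f x) ≈ f a
    Σᶠ-δ {f} f-cong a = begin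
      Σᶠ (λ x → δ a x * f x)                         ≈⟨ sum-single (λ i → δ a (enum i) * f (enum i)) (index a) off ⟩
      δ a (enum (index a)) * f (enum (index a))      ≈⟨ *-cong (δ-≈ (sym (enum-index a))) (f-cong (enum-index a)) ⟩
      1# * f a                                       ≈⟨ *-identityˡ (f a) ⟩
      f a                                            ∎
      where
      off : ∀ j → j ≢ index a → δ a (enum j) * f (enum j) ≈ 0#
      off j j≢ = trans (*-congʳ (δ-≉ λ a≈ → j≢ (≡.trans (≡.sym (index-enum j)) (index-cong (sym a≈))))) (zeroˡ _)

  -- Power sums

  -- Translation by 1 permutes the field, so Σ x = Σ (x + 1) = Σ x + q · 1.
  q×1≈0 : q ᴺ× 1# ≈ 0#
  q×1≈0 = ∙-cancelˡ (Σᶠ (λ x → x)) _ _ (begin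
    Σᶠ (λ x → x) + q ᴺ× 1#             ≈⟨ +-congˡ (Σᶠ-const 1#) ⟨
    Σᶠ (λ x → x) + Σᶠ (λ _ → 1#)       ≈⟨ Σᶠ-+ (λ x → x) (λ _ → 1#) ⟨
    Σᶠ (λ x → x + 1#)                  ≈⟨ Σᶠ-cong (λ x → +-comm x 1#) ⟩
    Σᶠ (λ x → 1# + x)                  ≈⟨ Σᶠ-bijection (λ eq → eq) (translation 1#) ⟩
    Σᶠ (λ x → x)                       ≈⟨ +-identityʳ _ ⟨
    Σᶠ (λ x → x) + 0#                  ∎)

  ∏-≉0 : ∀ {k} (f : Fin k → Carrier) → (∀ i → ¬ f i ≈ 0#) → ¬ ∏.sum f ≈ 0#
  ∏-≉0 {zero}  f f≉0 = 0≉1 ∘ sym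
  ∏-≉0 {suc k} f f≉0 = *-≉0 (f≉0 zero) (∏-≉0 (f ∘ suc) (f≉0 ∘ suc))

  -- The value 1 at zero lets a product over the whole field stand for a product over the units.
  onUnits : Carrier → Carrier → Carrier
  onUnits a x = if does (x ≟ 0#) then 1# else a

  -- Multiplication by y permutes the units, so their product W satisfies W · y^(q-1) = W, and W can
  -- be cancelled because it is nonzero.
  fermat : ∀ {y} → ¬ y ≈ 0# → y ^ suc n ≈ 1#
  fermat {y} y≉0 = *-cancelˡ-1 (∏-≉0 (unit ∘ enum) (λ i → unit≉0 (enum i))) (begin
    W * y ^ suc n                                     ≈⟨ *-congˡ (∏.sum-replicate (suc n)) ⟨
    -- The factor at 0 is 1; removing it from the product over the field leaves q - 1 factors y.
    W * ∏.sum {suc n} (λ _ → y)                       ≈⟨ *-congˡ (trans (*-congʳ atZero) (*-identityˡ _)) ⟨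
    W * (onUnits y (enum (index 0#)) * ∏.sum {suc n} (λ _ → y)) ≈⟨ *-congˡ (*-congˡ (∏.sum-cong-≋ offZero)) ⟨
    W * (onUnits y (enum (index 0#)) * ∏.sum (λ j → onUnits y (enum (punchIn (index 0#) j))))
                                                      ≈⟨ *-congˡ (∏.sum-remove {i = index 0#} (onUnits y ∘ enum)) ⟨
    W * ∏.sum (onUnits y ∘ enum)                      ≈⟨ *-comm _ _ ⟩
    ∏.sum (onUnits y ∘ enum) * W                      ≈⟨ ∏.∑-distrib-+ (onUnits y ∘ enum) (unit ∘ enum) ⟨
    ∏.sum (λ i → onUnits y (enum i) * unit (enum i))  ≈⟨ ∏.sum-cong-≋ (λ i → trans (unit-cong (enum-index _)) (unit-* (enum i))) ⟨
    ∏.sum (unit ∘ enum ∘ index ∘ to ∘ enum)           ≈⟨ ∏.sum-permute (unit ∘ enum) onIndices ⟨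
    W                                                 ∎)
    where
    open Bijection (scaling y y≉0) using (onIndices)
    to = y *_
    unit : Carrier → Carrier
    unit x = onUnits x x
    W = ∏.sum (unit ∘ enum)
    unit≉0 : ∀ x → ¬ unit x ≈ 0#
    unit≉0 x with x ≟ 0#
    ... | yes _  = 0≉1 ∘ sym
    ... | no x≉0 = x≉0
    unit-cong : ∀ {x x′} → x ≈ x′ → unit x ≈ unit x′
    unit-cong {x} {x′} x≈x′ with x ≟ 0# | x′ ≟ 0#
    ... | yes _   | yes _    = refl
    ... | yes x≈0 | no x′≉0  = contradiction (trans (sym x≈x′) x≈0) x′≉0
    ... | no x≉0  | yes x′≈0 = contradiction (trans x≈x′ x′≈0) x≉0
    ... | no _    | no _     = x≈x′
    unit-* : ∀ x → unit (y * x) ≈ onUnits y x * unit x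
    unit-* x with y * x ≟ 0# | x ≟ 0#
    ... | yes _    | yes _   = sym (*-identityˡ 1#)
    ... | yes yx≈0 | no x≉0  = contradiction yx≈0 (*-≉0 y≉0 x≉0)
    ... | no yx≉0  | yes x≈0 = contradiction (trans (*-congˡ x≈0) (zeroʳ y)) yx≉0
    ... | no _     | no _    = refl
    atZero : onUnits y (enum (index 0#)) ≈ 1#
    atZero with enum (index 0#) ≟ 0#
    ... | yes _ = refl
    ... | no ≉0 = contradiction (enum-index 0#) ≉0
    offZero : ∀ j → onUnits y (enum (punchIn (index 0#) j)) ≈ y
    offZero j with enum (punchIn (index 0#) j) ≟ 0#
    ... | yes ≈0 = contradiction (enum-injective (trans ≈0 (sym (enum-index 0#)))) (Finₚ.punchInᵢ≢i (index 0#) j)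
    ... | no _   = refl

  0^suc : ∀ k → 0# ^ suc k ≈ 0#
  0^suc k = zeroˡ _

  x^q≈x : ∀ x → x ^ q ≈ x
  x^q≈x x with x ≟ 0#
  ... | yes x≈0 = trans (^-congˡ q x≈0) (trans (0^suc (suc n)) (sym x≈0))
  ... | no x≉0  = trans (*-congˡ (fermat x≉0)) (*-identityʳ x)

  -- The vector holds the coefficients of 1, x, …, x^(k−1); the leading coefficient 1 is implicit.
  monic : ∀ {k} → Vec Carrier k → Carrier → Carrier
  monic []       x = 1#
  monic (a ∷ as) x = a + x * monic as x

  -- Synthetic division by x - a: the coefficients of the quotient are the intermediate Horner
  -- values at a, and the remainder is the value at a.
  quotient : ∀ {k} → Carrier → Vec Carrier (suc k) → Vec Carrier k
  quotient a (_ ∷ [])     = []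
  quotient a (_ ∷ b ∷ bs) = monic (b ∷ bs) a ∷ quotient a (b ∷ bs)

  monic-quotient : ∀ {k} a (as : Vec Carrier (suc k)) x →
    monic as x ≈ monic as a + (x - a) * monic (quotient a as) x
  monic-quotient a (b ∷ []) x = solve 3 (λ a b x → b :+ x :* con 1ℤ := b :+ a :* con 1ℤ :+ (x :- a) :* con 1ℤ) refl a b x
  monic-quotient a (b ∷ bs@(_ ∷ _)) x = begin
    b + x * monic bs x                                     ≈⟨ +-congˡ (*-congˡ (monic-quotient a bs x)) ⟩
    b + x * (monic bs a + (x - a) * monic (quotient a bs) x)
      ≈⟨ solve 5 (λ a b x p r → b :+ x :* (p :+ (x :- a) :* r) := b :+ a :* p :+ (x :- a) :* (p :+ x :* r)) refl a b x _ _ ⟩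
    b + a * monic bs a + (x - a) * (monic bs a + x * monic (quotient a bs) x) ∎

  -- Induction on the degree: after division by x minus the first root, the remaining roots are
  -- roots of the quotient, since their differences from the first are nonzero. In degree 0 the
  -- polynomial is 1.
  rootBound : ∀ {k} (as : Vec Carrier k) (root : Fin (suc k) → Carrier) →
    (∀ {i j} → root i ≈ root j → i ≡ j) → ¬ (∀ i → monic as (root i) ≈ 0#)
  rootBound []          root inj isRoot = 0≉1 (sym (isRoot zero))
  rootBound as@(_ ∷ _) root inj isRoot =
    rootBound (quotient a as) (root ∘ suc) (Finₚ.suc-injective ∘ inj) λ i →
      *-cancelˡ-0 (λ x-a≈0 → contradiction (inj (x∙y⁻¹≈ε⇒x≈y (root (suc i)) a x-a≈0)) λ ()) (begin
        (root (suc i) - a) * monic (quotient a as) (root (suc i))                  ≈⟨ +-identityˡ _ ⟨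
        0# + (root (suc i) - a) * monic (quotient a as) (root (suc i))             ≈⟨ +-congʳ (isRoot zero) ⟨
        monic as a + (root (suc i) - a) * monic (quotient a as) (root (suc i))     ≈⟨ monic-quotient a as (root (suc i)) ⟨
        monic as (root (suc i))                                                    ≈⟨ isRoot (suc i) ⟩
        0#                                                                         ∎)
    where a = root zero

  monic-power : ∀ k x → monic (Vec.replicate k 0#) x ≈ x ^ k
  monic-power zero    x = refl
  monic-power (suc k) x = trans (+-identityˡ _) (*-congˡ (monic-power k x))

  -- Otherwise x(x^(k+1) - 1), of degree k + 2 < q, would vanish on the whole field. The extra
  -- factor x makes 0 a root as well, so any k + 3 enumerated elements serve and the units need no
  -- enumeration of their own.
  ¬-all-power≈1 : ∀ k → suc k ℕ.< suc n → ¬ (∀ x → ¬ x ≈ 0# → x ^ suc k ≈ 1#)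
  ¬-all-power≈1 k k<n all≈1 =
    rootBound (0# ∷ - 1# ∷ Vec.replicate k 0#) (λ i → enum (inject≤ i (s≤s k<n)))
      (Finₚ.inject≤-injective _ _ _ _ ∘ enum-injective) (λ i → vanish (enum (inject≤ i (s≤s k<n))))
    where
    vanish : ∀ x → 0# + x * (- 1# + x * monic (Vec.replicate k 0#) x) ≈ 0#
    vanish x with x ≟ 0#
    ... | yes x≈0 = trans (+-identityˡ _) (trans (*-congʳ x≈0) (zeroˡ _))
    ... | no x≉0  = begin
      0# + x * (- 1# + x * monic (Vec.replicate k 0#) x)   ≈⟨ +-congˡ (*-congˡ (+-congˡ (*-congˡ (monic-power k x)))) ⟩
      0# + x * (- 1# + x ^ suc k)                          ≈⟨ +-congˡ (*-congˡ (+-congˡ (all≈1 x x≉0))) ⟩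
      0# + x * (- 1# + 1#)                                 ≈⟨ solve 1 (λ x → con 0ℤ :+ x :* (:- con 1ℤ :+ con 1ℤ) := con 0ℤ) refl x ⟩
      0#                                                   ∎

  powerSum : ℕ → Carrier
  powerSum k = Σᶠ (_^ k)

  powerSum-scale : ∀ k {g} → ¬ g ≈ 0# → powerSum k * g ^ k ≈ powerSum k
  powerSum-scale k {g} g≉0 = begin
    powerSum k * g ^ k               ≈⟨ Σᶠ-*ʳ (g ^ k) (_^ k) ⟨
    Σᶠ (λ x → x ^ k * g ^ k)         ≈⟨ Σᶠ-cong (λ x → trans (*-comm _ _) (sym (^-distrib-* g x k))) ⟩
    Σᶠ (λ x → (g * x) ^ k)           ≈⟨ Σᶠ-bijection (^-congˡ k) (scaling g g≉0) ⟩
    powerSum k                       ∎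

  -- If the sum were nonzero, it could be cancelled from `powerSum-scale`, which would make every
  -- unit a root of x^k = 1.
  powerSum-small : ∀ {k} → k ℕ.< suc n → powerSum k ≈ 0#
  -- `x ^ 0` is 1 also at x = 0, so all q terms are 1.
  powerSum-small {zero}  _   = trans (Σᶠ-const 1#) q×1≈0
  powerSum-small {suc k} k<n with powerSum (suc k) ≟ 0#
  ... | yes T≈0 = T≈0
  ... | no T≉0  = contradiction (λ x x≉0 → *-cancelˡ-1 T≉0 (powerSum-scale (suc k) x≉0)) (¬-all-power≈1 k k<n)

  power-q-1 : ∀ x → x ^ suc n ≈ 1# - δ 0# x
  power-q-1 x with 0# ≟ x
  ... | yes 0≈x = trans (^-congˡ (suc n) (sym 0≈x)) (trans (0^suc n) (sym (-‿inverseʳ 1#)))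
  ... | no 0≉x  = trans (fermat (0≉x ∘ sym)) (solve 0 (con 1ℤ := con 1ℤ :- con 0ℤ) refl)

  Σᶠ-δ-1 : ∀ a → Σᶠ (δ a) ≈ 1#
  Σᶠ-δ-1 a = trans (Σᶠ-cong (λ x → sym (*-identityʳ (δ a x)))) (Σᶠ-δ (λ _ → refl) a)

  powerSum-q-1 : powerSum (suc n) ≈ - 1#
  powerSum-q-1 = begin
    powerSum (suc n)                          ≈⟨ Σᶠ-cong power-q-1 ⟩
    Σᶠ (λ x → 1# - δ 0# x)                    ≈⟨ Σᶠ-+ (λ _ → 1#) (λ x → - δ 0# x) ⟩
    Σᶠ (λ _ → 1#) + Σᶠ (λ x → - δ 0# x)       ≈⟨ +-cong (powerSum-small z<s) (trans (Σᶠ-neg (δ 0#)) (-‿cong (Σᶠ-δ-1 0#))) ⟩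
    0# - 1#                                   ≈⟨ +-identityˡ _ ⟩
    - 1#                                      ∎

  -- Only positive exponents are periodic: at x = 0 the power with exponent 0 is 1, but the one with
  -- exponent q - 1 is 0.
  powerSum-periodic : ∀ k → powerSum (suc n ℕ.+ suc k) ≈ powerSum (suc k)
  powerSum-periodic k = Σᶠ-cong λ x → begin
    x ^ (suc n ℕ.+ suc k)       ≡⟨ ≡.cong (x ^_) (ℕₚ.+-suc (suc n) k) ⟩
    x ^ (q ℕ.+ k)               ≈⟨ ^-homo-* x q k ⟩
    x ^ q * x ^ k               ≈⟨ *-congʳ (x^q≈x x) ⟩
    x ^ suc k                   ∎

  -- The upper bound must be strict, because the sum is -1 again at 2(q-1).
  powerSum-≢ : ∀ {k} → k ≢ suc n → k ℕ.< suc n ℕ.+ suc n → powerSum k ≈ 0#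
  powerSum-≢ {k} k≢ k< with ℕₚ.<-cmp k (suc n)
  ... | tri< k<q-1 _ _ = powerSum-small k<q-1
  ... | tri≈ _ k≡q-1 _ = contradiction k≡q-1 k≢
  ... | tri> _ _ k>q-1 with ℕₚ.m≤n⇒∃[o]m+o≡n k>q-1
  ...   | j , ≡.refl = begin
    powerSum (suc (suc n ℕ.+ j))       ≡⟨ ≡.cong powerSum (ℕₚ.+-suc (suc n) j) ⟨
    powerSum (suc n ℕ.+ suc j)         ≈⟨ powerSum-periodic j ⟩
    powerSum (suc j)                   ≈⟨ powerSum-small (ℕₚ.+-cancelˡ-< (suc n) (suc j) (suc n) (≡.subst (ℕ._< suc n ℕ.+ suc n) (≡.sym (ℕₚ.+-suc (suc n) j)) k<)) ⟩
    0#                                 ∎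

-- Exponent vectors.

module Exponents where

  infixl 6 _∔_
  _∔_ : ∀ {n} → Vec ℕ n → Vec ℕ n → Vec ℕ n
  _∔_ = zipWith ℕ._+_

  single : ∀ {n} → Fin n → ℕ → Vec ℕ n
  single {n} i k = replicate n 0 [ i ]≔ k

  ∔-replicate-0 : ∀ {n} (e : Vec ℕ n) → e ∔ replicate n 0 ≡ e
  ∔-replicate-0 = Vecₚ.zipWith-identityʳ ℕₚ.+-identityʳ

  single-∔ : ∀ {n} (i : Fin n) j k → single i j ∔ single i k ≡ single i (j ℕ.+ k)
  single-∔ zero    j k = ≡.cong (j ℕ.+ k ∷_) (∔-replicate-0 _)
  single-∔ (suc i) j k = ≡.cong (0 ∷_) (single-∔ i j k)

  sum-∔-single : ∀ {n} (e : Vec ℕ n) i k → Vec.sum (e ∔ single i k) ≡ Vec.sum e ℕ.+ k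
  sum-∔-single (m ∷ e) zero    k = begin
    m ℕ.+ k ℕ.+ Vec.sum (e ∔ replicate _ 0)   ≡⟨ ≡.cong (λ d → m ℕ.+ k ℕ.+ Vec.sum d) (∔-replicate-0 e) ⟩
    m ℕ.+ k ℕ.+ Vec.sum e                     ≡⟨ ℕₚ.+-assoc m k _ ⟩
    m ℕ.+ (k ℕ.+ Vec.sum e)                   ≡⟨ ≡.cong (m ℕ.+_) (ℕₚ.+-comm k _) ⟩
    m ℕ.+ (Vec.sum e ℕ.+ k)                   ≡⟨ ℕₚ.+-assoc m _ k ⟨
    m ℕ.+ Vec.sum e ℕ.+ k                     ∎
    where open ≡.≡-Reasoning
  sum-∔-single (m ∷ e) (suc i) k = begin
    m ℕ.+ 0 ℕ.+ Vec.sum (e ∔ single i k)   ≡⟨ ≡.cong₂ ℕ._+_ (ℕₚ.+-identityʳ m) (sum-∔-single e i k) ⟩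
    m ℕ.+ (Vec.sum e ℕ.+ k)                ≡⟨ ℕₚ.+-assoc m _ k ⟨
    m ℕ.+ Vec.sum e ℕ.+ k                  ∎
    where open ≡.≡-Reasoning

  split-single : ∀ {n} (e : Vec ℕ n) i {k} → k ℕ.≤ lookup e i → ∃ λ d → e ≡ d ∔ single i k
  split-single (m ∷ e) zero    {k} k≤m = m ℕ.∸ k ∷ e , ≡.sym (≡.cong₂ _∷_ (ℕₚ.m∸n+n≡m k≤m) (∔-replicate-0 e))
  split-single (m ∷ e) (suc i)     k≤  with split-single e i k≤
  ... | d , e≡ = m ∷ d , ≡.cong₂ _∷_ (≡.sym (ℕₚ.+-identityʳ m)) e≡

-- Formal polynomials: linear functionals, evaluation, reduction.

module PolynomialTheory {c ℓ : Level} (R : CommutativeRing c ℓ) where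
  open CommutativeRing R hiding (zero)
  open Polynomials R
  open Exponents
  open IntegerCoefficients R using (solve; _:=_; _:+_; _:*_; _:-_; :-_; con)
  open SingleSupport +-commutativeMonoid
  open import Algebra.Properties.CommutativeSemiring.Exp commutativeSemiring using (_^_; ^-congˡ; ^-homo-*)
  open import Algebra.Properties.Semiring.Sum semiring using (sum; sum-cong-≋; ∑-distrib-+)
  open import Algebra.Properties.Group +-group using (x∙y⁻¹≈ε⇒x≈y; ε⁻¹≈ε)
  open import Relation.Binary.Reasoning.Setoid setoid

  infix 4 _≟ᵉ_
  _≟ᵉ_ : ∀ {n} → Decidable {A = Exponent n} _≡_
  _≟ᵉ_ = Vecₚ.≡-dec ℕₚ._≟_

  -- Coefficients, values at points and moments are all of this form, for `indicator e`, `mono x`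
  -- and `powerSums d`, so their common properties are proved once.
  linear : ∀ {n} → (Exponent n → Carrier) → Poly n → Carrier
  linear φ []            = 0#
  linear φ ((a , e) ∷ P) = a * φ e + linear φ P

  linear-++ : ∀ {n} (φ : Exponent n → Carrier) P Q → linear φ (P ++ Q) ≈ linear φ P + linear φ Q
  linear-++ φ []            Q = sym (+-identityˡ _)
  linear-++ φ ((a , e) ∷ P) Q = trans (+-congˡ (linear-++ φ P Q)) (sym (+-assoc _ _ _))

  linear-neg : ∀ {n} (φ : Exponent n → Carrier) P → linear φ (map (λ (b , e) → - b , e) P) ≈ - linear φ P
  linear-neg φ []            = sym ε⁻¹≈ε
  linear-neg φ ((a , e) ∷ P) = trans (+-congˡ (linear-neg φ P))
    (solve 3 (λ a b c → :- a :* b :+ :- c := :- (a :* b :+ c)) refl a (φ e) (linear φ P))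

  linear-⊖ : ∀ {n} (φ : Exponent n → Carrier) P Q → linear φ (P ⊖ Q) ≈ linear φ P - linear φ Q
  linear-⊖ φ P Q = trans (linear-++ φ P _) (+-congˡ (linear-neg φ Q))

  linear-scale : ∀ {n} s (φ : Exponent n → Carrier) P → linear (λ e → s * φ e) P ≈ s * linear φ P
  linear-scale s φ []            = sym (zeroʳ s)
  linear-scale s φ ((a , e) ∷ P) = trans (+-congˡ (linear-scale s φ P))
    (solve 4 (λ s a f r → a :* (s :* f) :+ s :* r := s :* (a :* f :+ r)) refl s a (φ e) (linear φ P))

  linear-difference : ∀ {n} (φ ψ : Exponent n → Carrier) P →
    linear (λ e → φ e - ψ e) P ≈ linear φ P - linear ψ P
  linear-difference φ ψ []            = sym (-‿inverseʳ 0#)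
  linear-difference φ ψ ((a , e) ∷ P) = trans (+-congˡ (linear-difference φ ψ P))
    (solve 5 (λ a f g r s → a :* (f :- g) :+ (r :- s) := a :* f :+ r :- (a :* g :+ s)) refl
      a (φ e) (ψ e) (linear φ P) (linear ψ P))

  indicator : ∀ {n} → Exponent n → Exponent n → Carrier
  indicator e d = if does (d ≟ᵉ e) then 1# else 0#

  coeff-linear : ∀ {n} (P : Poly n) e → coeff P e ≈ linear (indicator e) P
  coeff-linear []            e = refl
  coeff-linear ((a , d) ∷ P) e = +-cong (if-* (does (d ≟ᵉ e))) (coeff-linear P e)
    where
    if-* : ∀ b → (if b then a else 0#) ≈ a * (if b then 1# else 0#)
    if-* true  = sym (*-identityʳ a)
    if-* false = sym (zeroʳ a)

  coeff-++ : ∀ {n} (P Q : Poly n) e → coeff (P ++ Q) e ≈ coeff P e + coeff Q e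
  coeff-++ []      Q e = sym (+-identityˡ _)
  coeff-++ (_ ∷ P) Q e = trans (+-congˡ (coeff-++ P Q e)) (sym (+-assoc _ _ _))

  coeff-⊖ : ∀ {n} (P Q : Poly n) e → coeff (P ⊖ Q) e ≈ coeff P e - coeff Q e
  coeff-⊖ P Q e = trans (coeff-linear (P ⊖ Q) e)
    (trans (linear-⊖ (indicator e) P Q) (sym (+-cong (coeff-linear P e) (-‿cong (coeff-linear Q e)))))

  -- An exponent may occur in several terms; deleting all of them at once, with `coeff P d`
  -- accounting for their joint contribution, is how terms get collected.
  without : ∀ {n} → Exponent n → Poly n → Poly n
  without d []            = []
  without d ((a , e) ∷ P) with e ≟ᵉ d
  ... | yes _ = without d P
  ... | no  _ = (a , e) ∷ without d P

  length-without : ∀ {n} (d : Exponent n) P → length (without d P) ℕ.≤ length P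
  length-without d []            = z≤n
  length-without d ((a , e) ∷ P) with e ≟ᵉ d
  ... | yes _ = ℕₚ.m≤n⇒m≤1+n (length-without d P)
  ... | no  _ = s≤s (length-without d P)

  linear-without : ∀ {n} (φ : Exponent n → Carrier) d P → linear φ P ≈ coeff P d * φ d + linear φ (without d P)
  linear-without φ d []            = solve 1 (λ f → con 0ℤ := con 0ℤ :* f :+ con 0ℤ) refl (φ d)
  linear-without φ d ((a , e) ∷ P) with e ≟ᵉ d
  ... | yes ≡.refl = trans (+-congˡ (linear-without φ d P))
    (solve 4 (λ a f k r → a :* f :+ (k :* f :+ r) := (a :+ k) :* f :+ r) refl a (φ d) (coeff P d) (linear φ (without d P)))
  ... | no _       = trans (+-congˡ (linear-without φ d P))
    (solve 4 (λ x f k r → x :+ (k :* f :+ r) := (con 0ℤ :+ k) :* f :+ (x :+ r)) refl (a * φ e) (φ d) (coeff P d) (linear φ (without d P)))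

  coeff-without-≡ : ∀ {n} (d : Exponent n) P → coeff (without d P) d ≈ 0#
  coeff-without-≡ d []            = refl
  coeff-without-≡ d ((a , e) ∷ P) with e ≟ᵉ d
  ... | yes _   = coeff-without-≡ d P
  ... | no e≢d with e ≟ᵉ d
  ...   | yes e≡d = contradiction e≡d e≢d
  ...   | no _    = trans (+-identityˡ _) (coeff-without-≡ d P)

  coeff-without-≢ : ∀ {n} {d e : Exponent n} → d ≢ e → ∀ P → coeff (without d P) e ≈ coeff P e
  coeff-without-≢ d≢e [] = refl
  coeff-without-≢ {d = d} {e} d≢e ((a , f) ∷ P) with f ≟ᵉ d
  ... | no _       = +-congˡ (coeff-without-≢ d≢e P)
  ... | yes ≡.refl with f ≟ᵉ e
  ...   | yes d≡e = contradiction d≡e d≢e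
  ...   | no _    = trans (coeff-without-≢ d≢e P) (sym (+-identityˡ _))

  -- The hypothesis concerns collected coefficients, so the head is treated together with all later
  -- terms of the same exponent. What is left is not a sublist given by pattern matching, whence the
  -- recursion on length.
  linear-zero : ∀ {n} (φ : Exponent n → Carrier) P → (∀ e → coeff P e * φ e ≈ 0#) → linear φ P ≈ 0#
  linear-zero φ P = go P (<-wellFounded (length P))
    where
    go : ∀ P → Acc ℕ._<_ (length P) → (∀ e → coeff P e * φ e ≈ 0#) → linear φ P ≈ 0#
    go []            _         _ = refl
    go ((a , d) ∷ P) (acc rec) h = begin
      a * φ d + linear φ P                                        ≈⟨ +-congˡ (linear-without φ d P) ⟩
      a * φ d + (coeff P d * φ d + linear φ (without d P))        ≈⟨ solve 4 (λ a f k r → a :* f :+ (k :* f :+ r) := (a :+ k) :* f :+ r) refl a (φ d) (coeff P d) _ ⟩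
      (a + coeff P d) * φ d + linear φ (without d P)              ≈⟨ +-cong (head-zero) (go (without d P) (rec (s≤s (length-without d P))) tail-zero) ⟩
      0# + 0#                                                     ≈⟨ +-identityˡ 0# ⟩
      0#                                                          ∎
      where
      head-zero : (a + coeff P d) * φ d ≈ 0#
      head-zero with h d
      ... | hd with d ≟ᵉ d
      ...   | yes _  = hd
      ...   | no d≢d = contradiction ≡.refl d≢d
      tail-zero : ∀ e → coeff (without d P) e * φ e ≈ 0#
      tail-zero e with h e
      ... | he with d ≟ᵉ e
      ...   | yes ≡.refl = trans (*-congʳ (coeff-without-≡ d P)) (zeroˡ _)
      ...   | no d≢e     = trans (*-congʳ (trans (coeff-without-≢ d≢e P) (sym (+-identityˡ _)))) he

  -- Agreement is required only where the collected coefficient may be nonzero, even if other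
  -- exponents occur in the list; this is what makes reducedness usable.
  linear-cong-support : ∀ {n} {φ ψ : Exponent n → Carrier} P →
    (∀ e → coeff P e ≈ 0# ⊎ φ e ≈ ψ e) → linear φ P ≈ linear ψ P
  linear-cong-support {φ = φ} {ψ} P h = x∙y⁻¹≈ε⇒x≈y _ _
    (trans (sym (linear-difference φ ψ P)) (linear-zero (λ e → φ e - ψ e) P vanish))
    where
    vanish : ∀ e → coeff P e * (φ e - ψ e) ≈ 0#
    vanish e with h e
    ... | inj₁ c≈0 = trans (*-congʳ c≈0) (zeroˡ _)
    ... | inj₂ φ≈ψ = trans (*-congˡ (trans (+-congʳ φ≈ψ) (-‿inverseʳ (ψ e)))) (zeroʳ _)

  linear-≋ : ∀ {n} (φ : Exponent n → Carrier) P Q → P ≋ Q → linear φ P ≈ linear φ Q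
  linear-≋ φ P Q P≋Q = x∙y⁻¹≈ε⇒x≈y _ _ (trans (sym (linear-⊖ φ P Q))
    (linear-zero φ (P ⊖ Q) λ e → trans (*-congʳ (trans (coeff-⊖ P Q e) (trans (+-congʳ (P≋Q e)) (-‿inverseʳ _)))) (zeroˡ _)))

  -- Evaluation

  mono : ∀ {n} → Vec Carrier n → Exponent n → Carrier
  mono []       []      = 1#
  mono (x ∷ xs) (k ∷ e) = x ^ k * mono xs e

  mono-∔ : ∀ {n} (x : Vec Carrier n) d e → mono x (d ∔ e) ≈ mono x d * mono x e
  mono-∔ []       []      []      = sym (*-identityˡ 1#)
  mono-∔ (x ∷ xs) (j ∷ d) (k ∷ e) = trans (*-cong (^-homo-* x j k) (mono-∔ xs d e))
    (solve 4 (λ a b c d → a :* b :* (c :* d) := a :* c :* (b :* d)) refl (x ^ j) (x ^ k) (mono xs d) (mono xs e))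

  mono-0 : ∀ {n} (x : Vec Carrier n) → mono x (replicate n 0) ≈ 1#
  mono-0 []       = refl
  mono-0 (x ∷ xs) = trans (*-identityˡ _) (mono-0 xs)

  mono-single-1 : ∀ {n} (x : Vec Carrier n) i → mono x (single i 1) ≈ lookup x i
  mono-single-1 (x ∷ xs) zero    = trans (*-congˡ (mono-0 xs)) (solve 1 (λ x → x :* con 1ℤ :* con 1ℤ := x) refl x)
  mono-single-1 (x ∷ xs) (suc i) = trans (*-identityˡ _) (mono-single-1 xs i)

  eval : ∀ {n} → Vec Carrier n → Poly n → Carrier
  eval x = linear (mono x)

  eval-const : ∀ {n} (x : Vec Carrier n) a → eval x (const a) ≈ a
  eval-const x a = trans (+-identityʳ _) (trans (*-congˡ (mono-0 x)) (*-identityʳ a))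

  eval-X : ∀ {n} (x : Vec Carrier n) i → eval x (X i) ≈ lookup x i
  eval-X x i = trans (+-identityʳ _) (trans (*-identityˡ _) (mono-single-1 x i))

  eval-term-⊗ : ∀ {n} (x : Vec Carrier n) a d Q →
    eval x (map (λ (b , e) → a * b , d ∔ e) Q) ≈ a * mono x d * eval x Q
  eval-term-⊗ x a d []            = sym (zeroʳ _)
  eval-term-⊗ x a d ((b , e) ∷ Q) = trans (+-cong (*-congˡ (mono-∔ x d e)) (eval-term-⊗ x a d Q))
    (solve 5 (λ a b m k r → a :* b :* (m :* k) :+ a :* m :* r := a :* m :* (b :* k :+ r)) refl
      a b (mono x d) (mono x e) (eval x Q))

  eval-⊗ : ∀ {n} (x : Vec Carrier n) P Q → eval x (P ⊗ Q) ≈ eval x P * eval x Q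
  eval-⊗ x []            Q = sym (zeroˡ _)
  eval-⊗ x ((a , d) ∷ P) Q = trans (linear-++ (mono x) (map _ Q) (P ⊗ Q))
    (trans (+-cong (eval-term-⊗ x a d Q) (eval-⊗ x P Q)) (sym (distribʳ _ _ _)))

  eval-^^ : ∀ {n} (x : Vec Carrier n) P k → eval x (P ^^ k) ≈ eval x P ^ k
  eval-^^ x P zero    = eval-const x 1#
  eval-^^ x P (suc k) = trans (eval-⊗ x P (P ^^ k)) (*-congˡ (eval-^^ x P k))

  eval-∑-zero : ∀ {n} {A : Set} (x : Vec Carrier n) (f : A → Poly n) → (∀ j → eval x (f j) ≈ 0#) →
    ∀ js → eval x (∑ (map f js)) ≈ 0#
  eval-∑-zero x f f≈0 []       = refl
  eval-∑-zero x f f≈0 (j ∷ js) = trans (linear-++ (mono x) (f j) _)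
    (trans (+-cong (f≈0 j) (eval-∑-zero x f f≈0 js)) (+-identityˡ 0#))

  eval-⟦⟧ : ∀ {n} (x : Vec Carrier n) (P : Poly 1) (σ : Fin 1 → Poly n) →
    eval x (P ⟦ σ ⟧) ≈ eval (eval x (σ 0F) ∷ []) P
  eval-⟦⟧ x []                  σ = refl
  eval-⟦⟧ x ((a , k ∷ []) ∷ P) σ = trans (linear-++ (mono x) (const a ⊗ (σ 0F ^^ k ⊗ const 1#)) (P ⟦ σ ⟧)) (+-cong
    (trans (eval-⊗ x (const a) (σ 0F ^^ k ⊗ const 1#)) (*-cong (eval-const x a)
      (trans (eval-⊗ x (σ 0F ^^ k) (const 1#)) (*-cong (eval-^^ x (σ 0F) k) (eval-const x 1#)))))
    (eval-⟦⟧ x P σ))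

  -- A point with x_j^q = x_j for all j is a common zero of the generators, hence of the whole
  -- ideal.
  eval-CongruentMod : ∀ {n} q (x : Vec Carrier n) → (∀ i → lookup x i ^ q ≈ lookup x i) →
    ∀ {P Q} → CongruentMod q P Q → eval x P ≈ eval x Q
  eval-CongruentMod q x fixed {P} {Q} (A , P⊖Q≋) = x∙y⁻¹≈ε⇒x≈y _ _ (begin
    eval x P - eval x Q     ≈⟨ linear-⊖ (mono x) P Q ⟨
    eval x (P ⊖ Q)          ≈⟨ linear-≋ (mono x) (P ⊖ Q) S P⊖Q≋ ⟩
    eval x S                ≈⟨ eval-∑-zero x _ vanish (allFin _) ⟩
    0#                      ∎)
    where
    S = ∑ (map (λ j → A j ⊗ (X j ^^ q ⊖ X j)) (allFin _))
    vanish : ∀ j → eval x (A j ⊗ (X j ^^ q ⊖ X j)) ≈ 0#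
    vanish j = begin
      eval x (A j ⊗ (X j ^^ q ⊖ X j))                 ≈⟨ eval-⊗ x (A j) _ ⟩
      eval x (A j) * eval x (X j ^^ q ⊖ X j)          ≈⟨ *-congˡ (linear-⊖ (mono x) (X j ^^ q) (X j)) ⟩
      eval x (A j) * (eval x (X j ^^ q) - eval x (X j)) ≈⟨ *-congˡ (+-cong (trans (eval-^^ x (X j) q) (^-congˡ q (eval-X x j))) (-‿cong (eval-X x j))) ⟩
      eval x (A j) * (lookup x j ^ q - lookup x j)    ≈⟨ *-congˡ (trans (+-congʳ (fixed j)) (-‿inverseʳ _)) ⟩
      eval x (A j) * 0#                               ≈⟨ zeroʳ _ ⟩
      0#                                              ∎

  -- Reduction modulo the polynomials x_j^q − x_j

  coeff-∑ : ∀ {m n} (f : Fin m → Poly n) e → coeff (∑ (map f (allFin m))) e ≈ sum (λ j → coeff (f j) e)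
  coeff-∑ {m} f e = trans (reflexive (≡.cong (λ Ps → coeff (∑ Ps) e) (Listₚ.map-tabulate (λ i → i) f))) (tab f)
    where
    tab : ∀ {m} (f : Fin m → Poly _) → coeff (∑ (List.tabulate f)) e ≈ sum (λ j → coeff (f j) e)
    tab {zero}  f = refl
    tab {suc m} f = trans (coeff-++ (f zero) _ e) (+-congˡ (tab (f ∘ suc)))

  coeff-++-⊗ : ∀ {n} (P Q S : Poly n) e → coeff ((P ++ Q) ⊗ S) e ≈ coeff (P ⊗ S) e + coeff (Q ⊗ S) e
  coeff-++-⊗ P Q S e = trans
    (reflexive (≡.cong (λ T → coeff T e) (Listₚ.cartesianProductWith-distribʳ-++ _ P Q S)))
    (coeff-++ (P ⊗ S) (Q ⊗ S) e)

  -- The coefficient is a literal product of ones, equal to `1#` only up to `≈`, while the shape of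
  -- the list holds up to `≡` and can be used for rewriting.
  X-^^ : ∀ {n} (i : Fin n) k → ∃ λ a → a ≈ 1# × X i ^^ k ≡ (a , single i k) ∷ []
  X-^^ {n} i zero    = 1# , refl , ≡.cong (λ e → (1# , e) ∷ []) (single-0 i)
    where
    single-0 : ∀ {n} (i : Fin n) → replicate n 0 ≡ single i 0
    single-0 zero    = ≡.refl
    single-0 (suc i) = ≡.cong (0 ∷_) (single-0 i)
  X-^^ i (suc k) with X-^^ i k
  ... | a , a≈1 , eq = 1# * a , trans (*-identityˡ a) a≈1 ,
    ≡.trans (≡.cong (X i ⊗_) eq) (≡.cong (λ e → (1# * a , e) ∷ []) (single-∔ i 1 k))

  module Reduction (n : ℕ) where
    q : ℕ
    q = suc (suc n)

    ideal : ∀ {m} → (Fin m → Poly m) → Exponent m → Carrier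
    ideal A e = sum (λ j → coeff (A j ⊗ (X j ^^ q ⊖ X j)) e)

    -- CongruentMod with the coefficients expanded; a record, so that P and Q can be inferred.
    infix 4 _∼_
    record _∼_ {m : ℕ} (P Q : Poly m) : Set (c ⊔ ℓ) where
      constructor _,_
      field
        cofactor : Fin m → Poly m
        identity : ∀ e → coeff P e ≈ coeff Q e + ideal cofactor e

    ideal-++ : ∀ {m} (A B : Fin m → Poly m) e → ideal (λ j → A j ++ B j) e ≈ ideal A e + ideal B e
    ideal-++ A B e = trans
      (sum-cong-≋ (λ j → coeff-++-⊗ (A j) (B j) (X j ^^ q ⊖ X j) e))
      (∑-distrib-+ (λ j → coeff (A j ⊗ (X j ^^ q ⊖ X j)) e) (λ j → coeff (B j ⊗ (X j ^^ q ⊖ X j)) e))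

    ∼-refl : ∀ {m} (P : Poly m) → P ∼ P
    ∼-refl {m} P = (λ _ → []) , λ e → sym (trans (+-congˡ (sum-zero {m} (λ _ → refl))) (+-identityʳ _))

    ∼-trans : ∀ {m} {P Q S : Poly m} → P ∼ Q → Q ∼ S → P ∼ S
    ∼-trans {P = P} {Q} {S} (A , P∼Q) (B , Q∼S) = (λ j → B j ++ A j) , λ e → begin
      coeff P e                           ≈⟨ P∼Q e ⟩
      coeff Q e + ideal A e               ≈⟨ +-congʳ (Q∼S e) ⟩
      coeff S e + ideal B e + ideal A e   ≈⟨ +-assoc _ _ _ ⟩
      coeff S e + (ideal B e + ideal A e) ≈⟨ +-congˡ (ideal-++ B A e) ⟨
      coeff S e + ideal (λ j → B j ++ A j) e ∎

    ∼-++ : ∀ {m} {P Q P′ Q′ : Poly m} → P ∼ Q → P′ ∼ Q′ → P ++ P′ ∼ Q ++ Q′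
    ∼-++ {P = P} {Q} {P′} {Q′} (A , P∼Q) (B , P′∼Q′) = (λ j → A j ++ B j) , λ e → begin
      coeff (P ++ P′) e                                   ≈⟨ coeff-++ P P′ e ⟩
      coeff P e + coeff P′ e                              ≈⟨ +-cong (P∼Q e) (P′∼Q′ e) ⟩
      coeff Q e + ideal A e + (coeff Q′ e + ideal B e)    ≈⟨ solve 4 (λ a b c d → a :+ b :+ (c :+ d) := a :+ c :+ (b :+ d)) refl (coeff Q e) (ideal A e) (coeff Q′ e) (ideal B e) ⟩
      coeff Q e + coeff Q′ e + (ideal A e + ideal B e)    ≈⟨ +-cong (coeff-++ Q Q′ e) (ideal-++ A B e) ⟨
      coeff (Q ++ Q′) e + ideal (λ j → A j ++ B j) e      ∎

    -- The difference is a x^d (x_i^q - x_i), so the only nonzero cofactor is a x^d, in place i.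
    ∼-step : ∀ {m} a (d : Exponent m) i → (a , d ∔ single i q) ∷ [] ∼ (a , d ∔ single i 1) ∷ []
    ∼-step a d i = A , λ e → sym (trans (+-congˡ (ideal-A e)) (cancel e))
      where
      A : Fin _ → Poly _
      A j = if does (j Finₚ.≟ i) then (a , d) ∷ [] else []
      on : ∀ e → coeff (A i ⊗ (X i ^^ q ⊖ X i)) e ≈ coeff (((a , d) ∷ []) ⊗ (X i ^^ q ⊖ X i)) e
      on e with i Finₚ.≟ i
      ... | yes _  = refl
      ... | no i≢i = contradiction ≡.refl i≢i
      off : ∀ e j → j ≢ i → coeff (A j ⊗ (X j ^^ q ⊖ X j)) e ≈ 0#
      off e j j≢i with j Finₚ.≟ i
      ... | yes j≡i = contradiction j≡i j≢i
      ... | no _    = refl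
      ideal-A : ∀ e → ideal A e ≈ coeff (((a , d) ∷ []) ⊗ (X i ^^ q ⊖ X i)) e
      ideal-A e = trans (sum-single (λ j → coeff (A j ⊗ (X j ^^ q ⊖ X j)) e) i (off e)) (on e)
      if-cong : ∀ b {x y} → x ≈ y → (if b then x else 0#) ≈ (if b then y else 0#)
      if-cong true  x≈y = x≈y
      if-cong false _   = refl
      if-neg : ∀ b → (if b then a * - 1# else 0#) ≈ - (if b then a else 0#)
      if-neg true  = solve 1 (λ a → a :* :- con 1ℤ := :- a) refl a
      if-neg false = sym ε⁻¹≈ε
      cancel : ∀ e → coeff ((a , d ∔ single i 1) ∷ []) e + coeff (((a , d) ∷ []) ⊗ (X i ^^ q ⊖ X i)) e
        ≈ coeff ((a , d ∔ single i q) ∷ []) e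
      cancel e with X-^^ i q
      ... | b , b≈1 , eq rewrite eq = trans
        (+-congˡ (+-cong (if-cong (does (d ∔ single i q ≟ᵉ e)) (trans (*-congˡ b≈1) (*-identityʳ a)))
                         (+-congʳ (if-neg (does (d ∔ single i 1 ≟ᵉ e))))))
        (solve 2 (λ x y → x :+ con 0ℤ :+ (y :+ (:- x :+ con 0ℤ)) := y :+ con 0ℤ) refl
          (if does (d ∔ single i 1 ≟ᵉ e) then a else 0#) (if does (d ∔ single i q ≟ᵉ e) then a else 0#))

    -- Replacing a factor x_i^q by x_i lowers the total degree by q - 1 > 0, which bounds the number
    -- of replacements.
    reduceMonomial : ∀ {m} a (d : Exponent m) → Acc ℕ._<_ (Vec.sum d) → ∃ λ S → IsReduced q S × (a , d) ∷ [] ∼ S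
    reduceMonomial a d (acc rec) with Finₚ.any? (λ i → q ℕₚ.≤? lookup d i)
    ... | no ¬large = (a , d) ∷ [] , reduced , ∼-refl _
      where
      reduced : IsReduced q ((a , d) ∷ [])
      reduced e i q≤e with d ≟ᵉ e
      ... | yes ≡.refl = contradiction (i , q≤e) ¬large
      ... | no _       = +-identityˡ 0#
    ... | yes (i , q≤d) with split-single d i q≤d
    ...   | d′ , ≡.refl with reduceMonomial a (d′ ∔ single i 1) (rec smaller)
      where
      smaller : Vec.sum (d′ ∔ single i 1) ℕ.< Vec.sum (d′ ∔ single i q)
      smaller = ≡.subst₂ ℕ._<_ (≡.sym (sum-∔-single d′ i 1)) (≡.sym (sum-∔-single d′ i q))
        (ℕₚ.+-monoʳ-< (Vec.sum d′) (s≤s z<s))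
    ...     | S , red , d∼S = S , red , ∼-trans (∼-step a d′ i) d∼S

    reduce : ∀ {m} (P : Poly m) → ∃ λ S → IsReduced q S × P ∼ S
    reduce []            = [] , (λ _ _ _ → refl) , ∼-refl []
    reduce ((a , d) ∷ P) with reduceMonomial a d (<-wellFounded _) | reduce P
    ... | S , S-red , d∼S | T , T-red , P∼T = S ++ T ,
      (λ e i q≤ → trans (coeff-++ S T e) (trans (+-cong (S-red e i q≤) (T-red e i q≤)) (+-identityˡ 0#))) ,
      ∼-++ d∼S P∼T

    reducedRepresentative : ∀ {m} (P : Poly m) → ∃ λ S → IsReducedRepresentative q P S
    reducedRepresentative P with reduce P
    ... | S , S-red , A , P∼S = S , S-red , A , λ e → begin
      coeff (P ⊖ S) e                       ≈⟨ coeff-⊖ P S e ⟩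
      coeff P e - coeff S e                 ≈⟨ +-congʳ (P∼S e) ⟩
      coeff S e + ideal A e - coeff S e     ≈⟨ solve 2 (λ s i → s :+ i :- s := i) refl (coeff S e) (ideal A e) ⟩
      ideal A e                             ≈⟨ coeff-∑ (λ j → A j ⊗ (X j ^^ q ⊖ X j)) e ⟨
      coeff (∑ (map (λ j → A j ⊗ (X j ^^ q ⊖ X j)) (allFin _))) e ∎

-- Coefficients of a reduced polynomial as moments over all points.

module CoefficientExtraction {c ℓ : Level} {n : ℕ} (F : FiniteField c ℓ (suc (suc n))) where
  open FiniteField F hiding (zero)
  open FiniteFieldTheory F
  open Polynomials commutativeRing
  open PolynomialTheory commutativeRing
  open IntegerCoefficients commutativeRing using (solve; _:=_; _:+_; _:*_)
  open import Algebra.Properties.CommutativeSemiring.Exp commutativeSemiring using (_^_; ^-homo-*)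
  open import Relation.Binary.Reasoning.Setoid setoid

  Σᵛ : ∀ k → (Vec Carrier k → Carrier) → Carrier
  Σᵛ zero    f = f []
  Σᵛ (suc k) f = Σᶠ λ a → Σᵛ k λ x → f (a ∷ x)

  Σᵛ-cong : ∀ k {f g} → (∀ x → f x ≈ g x) → Σᵛ k f ≈ Σᵛ k g
  Σᵛ-cong zero    f≈g = f≈g []
  Σᵛ-cong (suc k) f≈g = Σᶠ-cong λ a → Σᵛ-cong k λ x → f≈g (a ∷ x)

  Σᵛ-zero : ∀ k {f} → (∀ x → f x ≈ 0#) → Σᵛ k f ≈ 0#
  Σᵛ-zero zero    f≈0 = f≈0 []
  Σᵛ-zero (suc k) f≈0 = Σᶠ-zero λ a → Σᵛ-zero k λ x → f≈0 (a ∷ x)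

  Σᵛ-+ : ∀ k f g → Σᵛ k (λ x → f x + g x) ≈ Σᵛ k f + Σᵛ k g
  Σᵛ-+ zero    f g = refl
  Σᵛ-+ (suc k) f g = trans (Σᶠ-cong λ a → Σᵛ-+ k (λ x → f (a ∷ x)) (λ x → g (a ∷ x))) (Σᶠ-+ _ _)

  Σᵛ-*ˡ : ∀ k b f → Σᵛ k (λ x → b * f x) ≈ b * Σᵛ k f
  Σᵛ-*ˡ zero    b f = refl
  Σᵛ-*ˡ (suc k) b f = trans (Σᶠ-cong λ a → Σᵛ-*ˡ k b (λ x → f (a ∷ x))) (Σᶠ-*ˡ b _)

  powerSums : ∀ {k} → Exponent k → Exponent k → Carrier
  powerSums []      []      = 1#
  powerSums (i ∷ d) (j ∷ e) = powerSum (j ℕ.+ i) * powerSums d e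

  Σᵛ-mono : ∀ {k} (d e : Exponent k) → Σᵛ k (λ x → mono x e * mono x d) ≈ powerSums d e
  Σᵛ-mono []      []      = *-identityˡ 1#
  Σᵛ-mono {suc k} (i ∷ d) (j ∷ e) = begin
    Σᶠ (λ a → Σᵛ k (λ x → a ^ j * mono x e * (a ^ i * mono x d)))
      ≈⟨ Σᶠ-cong (λ a → trans (Σᵛ-cong k (λ x → trans
           (solve 4 (λ a b c d → a :* c :* (b :* d) := a :* b :* (c :* d)) refl (a ^ j) (a ^ i) (mono x e) (mono x d))
           (*-congʳ (sym (^-homo-* a j i))))) (Σᵛ-*ˡ k (a ^ (j ℕ.+ i)) _)) ⟩
    Σᶠ (λ a → a ^ (j ℕ.+ i) * Σᵛ k (λ x → mono x e * mono x d))   ≈⟨ Σᶠ-*ʳ _ (_^ (j ℕ.+ i)) ⟩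
    powerSum (j ℕ.+ i) * Σᵛ k (λ x → mono x e * mono x d)         ≈⟨ *-congˡ (Σᵛ-mono d e) ⟩
    powerSum (j ℕ.+ i) * powerSums d e                            ∎

  Σᵛ-eval : ∀ {k} (d : Exponent k) P → Σᵛ k (λ x → eval x P * mono x d) ≈ linear (powerSums d) P
  Σᵛ-eval {k} d []            = Σᵛ-zero k λ x → zeroˡ _
  Σᵛ-eval {k} d ((a , e) ∷ P) = begin
    Σᵛ k (λ x → (a * mono x e + eval x P) * mono x d)
      ≈⟨ Σᵛ-cong k (λ x → solve 4 (λ a m r d → (a :* m :+ r) :* d := a :* (m :* d) :+ r :* d) refl a (mono x e) (eval x P) (mono x d)) ⟩
    Σᵛ k (λ x → a * (mono x e * mono x d) + eval x P * mono x d)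
      ≈⟨ Σᵛ-+ k (λ x → a * (mono x e * mono x d)) (λ x → eval x P * mono x d) ⟩
    Σᵛ k (λ x → a * (mono x e * mono x d)) + Σᵛ k (λ x → eval x P * mono x d)
      ≈⟨ +-cong (trans (Σᵛ-*ˡ k a _) (*-congˡ (Σᵛ-mono d e))) (Σᵛ-eval d P) ⟩
    a * powerSums d e + linear (powerSums d) P ∎

  powerSums-≡ : ∀ {k} (d e : Exponent k) → (∀ i → lookup e i ℕ.+ lookup d i ≡ suc n) → powerSums d e ≈ (- 1#) ^ k
  powerSums-≡ []      []      _  = refl
  powerSums-≡ (i ∷ d) (j ∷ e) eq = *-cong
    (trans (reflexive (≡.cong powerSum (eq zero))) powerSum-q-1) (powerSums-≡ d e (eq ∘ suc))

  -- In a coordinate where `e′` differs from `e` the exponent is not q - 1 and lies below 2(q-1), so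
  -- the factor belonging to it vanishes.
  powerSums-≢ : ∀ {k} (d e e′ : Exponent k) → (∀ i → lookup e i ℕ.+ lookup d i ≡ suc n) →
    (∀ i → lookup d i ℕ.< suc n) → (∀ i → lookup e′ i ℕ.≤ suc n) → e′ ≢ e → powerSums d e′ ≈ 0#
  powerSums-≢ []      []      []        _  _  _   e′≢e = contradiction ≡.refl e′≢e
  powerSums-≢ (i ∷ d) (j ∷ e) (j′ ∷ e′) eq d< e′≤ e′≢e with j′ ℕₚ.≟ j
  ... | yes ≡.refl = trans (*-congˡ (powerSums-≢ d e e′ (eq ∘ suc) (d< ∘ suc) (e′≤ ∘ suc) (e′≢e ∘ ≡.cong (j ∷_)))) (zeroʳ _)
  ... | no j′≢j    = trans (*-congʳ (powerSum-≢
    (λ eq′ → j′≢j (ℕₚ.+-cancelʳ-≡ i j′ j (≡.trans eq′ (≡.sym (eq zero)))))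
    (ℕₚ.+-mono-≤-< (e′≤ zero) (d< zero)))) (zeroˡ _)

  -- The strict bound on d separates exponents 0 and q - 1: with d_i = q - 1, so e_i = 0, terms with
  -- exponent q - 1 in x_i would contribute too, through the power sum at 2(q-1).
  extract : ∀ {k} {P : Poly k} → IsReduced q P → (d e : Exponent k) →
    (∀ i → lookup e i ℕ.+ lookup d i ≡ suc n) → (∀ i → lookup d i ℕ.< suc n) →
    Σᵛ k (λ x → eval x P * mono x d) ≈ (- 1#) ^ k * coeff P e
  extract {k} {P} reduced d e eq d< = begin
    Σᵛ k (λ x → eval x P * mono x d)                ≈⟨ Σᵛ-eval d P ⟩
    linear (powerSums d) P                          ≈⟨ linear-cong-support P agree ⟩
    linear (λ e′ → (- 1#) ^ k * indicator e e′) P   ≈⟨ linear-scale ((- 1#) ^ k) (indicator e) P ⟩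
    (- 1#) ^ k * linear (indicator e) P             ≈⟨ *-congˡ (coeff-linear P e) ⟨
    (- 1#) ^ k * coeff P e                          ∎
    where
    agree : ∀ e′ → coeff P e′ ≈ 0# ⊎ powerSums d e′ ≈ (- 1#) ^ k * indicator e e′
    agree e′ with Finₚ.any? (λ i → q ℕₚ.≤? lookup e′ i)
    ... | yes (i , q≤e′) = inj₁ (reduced e′ i q≤e′)
    ... | no ¬large with e′ ≟ᵉ e
    ...   | yes ≡.refl = inj₂ (trans (powerSums-≡ d e eq) (sym (*-identityʳ _)))
    ...   | no e′≢e    = inj₂ (trans
      (powerSums-≢ d e e′ eq d< (λ i → ℕₚ.≤-pred (ℕₚ.≰⇒> λ q≤ → ¬large (i , q≤))) e′≢e) (sym (zeroʳ _)))

-- The function defined by the polynomial and its moments, for q = 5 + m.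

module Moments {c ℓ : Level} {m : ℕ} (F : FiniteField c ℓ (5 ℕ.+ m)) where
  n : ℕ
  n = 3 ℕ.+ m
  open FiniteField F hiding (zero)
  open FiniteFieldTheory F
  open Transposition F
  open PolynomialTheory commutativeRing
  open CoefficientExtraction F
  open IntegerCoefficients commutativeRing using (solve; _:=_; _:+_; _:*_; _:-_; :-_; con)
  open import Algebra.Properties.CommutativeSemiring.Exp commutativeSemiring using (_^_; ^-congˡ)
  open import Algebra.Properties.Semiring.Mult semiring using () renaming (_×_ to _ᴺ×_)
  open import Algebra.Properties.Group +-group using (x∙y⁻¹≈ε⇒x≈y; ∙-cancelˡ)
  open import Relation.Binary.Reasoning.Setoid setoid

  -- Inversion, with inv 0 = 0

  abstract
    inv : Carrier → Carrier
    inv x = x ^ n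

    inv-def : ∀ x → inv x ≈ x ^ n
    inv-def x = refl

    inv-cong : Congruent₁ _≈_ inv
    inv-cong = ^-congˡ n

    inv-0 : ∀ {x} → x ≈ 0# → inv x ≈ 0#
    inv-0 x≈0 = trans (^-congˡ n x≈0) (0^suc (suc (suc m)))

    inv-inverse : ∀ {x} → ¬ x ≈ 0# → x * inv x ≈ 1#
    inv-inverse = fermat

    x*inv-x : ∀ x → x * inv x ≈ 1# - δ 0# x
    x*inv-x = power-q-1

  inv-unique : ∀ {x y} → x * y ≈ 1# → inv x ≈ y
  inv-unique {x} {y} xy≈1 = begin
    inv x                ≈⟨ *-identityʳ _ ⟨
    inv x * 1#           ≈⟨ *-congˡ xy≈1 ⟨
    inv x * (x * y)      ≈⟨ solve 3 (λ i x y → i :* (x :* y) := x :* i :* y) refl (inv x) x y ⟩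
    x * inv x * y        ≈⟨ *-congʳ (inv-inverse x≉0) ⟩
    1# * y               ≈⟨ *-identityˡ y ⟩
    y                    ∎
    where
    x≉0 : ¬ x ≈ 0#
    x≉0 x≈0 = 0≉1 (trans (sym (trans (*-congʳ x≈0) (zeroˡ y))) xy≈1)

  inv-1 : inv 1# ≈ 1#
  inv-1 = inv-unique (*-identityˡ 1#)

  inv-neg : ∀ x → inv (- x) ≈ - inv x
  inv-neg x with x ≟ 0#
  ... | yes x≈0 = begin
    inv (- x)    ≈⟨ inv-0 (trans (-‿cong x≈0) neg-0) ⟩
    0#           ≈⟨ neg-0 ⟨
    - 0#         ≈⟨ -‿cong (inv-0 x≈0) ⟨
    - inv x      ∎
    where
    neg-0 : - 0# ≈ 0#
    neg-0 = solve 0 (:- con 0ℤ := con 0ℤ) refl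
  ... | no x≉0  = inv-unique (trans (solve 2 (λ x y → :- x :* :- y := x :* y) refl x (inv x)) (inv-inverse x≉0))

  inv-involutive : ∀ x → inv (inv x) ≈ x
  inv-involutive x with x ≟ 0#
  ... | yes x≈0 = trans (inv-0 (inv-0 x≈0)) (sym x≈0)
  ... | no x≉0  = inv-unique (trans (*-comm _ _) (inv-inverse x≉0))

  -- Partial fractions: 1/x + 1/y = (x + y)/(xy).
  inv-*-inv : ∀ {x y s} → ¬ x ≈ 0# → ¬ y ≈ 0# → ¬ s ≈ 0# → x + y ≈ s → inv x * inv y ≈ inv s * (inv x + inv y)
  inv-*-inv {x} {y} {s} x≉0 y≉0 s≉0 x+y≈s = begin
    inv x * inv y                                     ≈⟨ *-identityˡ _ ⟨
    1# * (inv x * inv y)                              ≈⟨ *-congʳ (inv-inverse s≉0) ⟨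
    s * inv s * (inv x * inv y)                       ≈⟨ *-congʳ (*-congʳ x+y≈s) ⟨
    (x + y) * inv s * (inv x * inv y)
      ≈⟨ solve 5 (λ x y c a b → (x :+ y) :* c :* (a :* b) := c :* (x :* a :* b :+ y :* b :* a)) refl x y (inv s) (inv x) (inv y) ⟩
    inv s * (x * inv x * inv y + y * inv y * inv x)
      ≈⟨ *-congˡ (+-cong (trans (*-congʳ (inv-inverse x≉0)) (*-identityˡ _)) (trans (*-congʳ (inv-inverse y≉0)) (*-identityˡ _))) ⟩
    inv s * (inv y + inv x)                           ≈⟨ *-congˡ (+-comm _ _) ⟩
    inv s * (inv x + inv y)                           ∎

  inversion : Bijection
  inversion = record
    { to        = inv
    ; from      = inv
    ; to-cong   = inv-cong
    ; from-cong = inv-cong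
    ; to-from   = inv-involutive
    ; from-to   = inv-involutive
    }

  Σᶠ-inv-power : ∀ {k} → k ℕ.< suc n → Σᶠ (λ x → inv x ^ k) ≈ 0#
  Σᶠ-inv-power {k} k<q-1 = trans (Σᶠ-bijection (^-congˡ k) inversion) (powerSum-small k<q-1)

  Σᶠ-inv : Σᶠ inv ≈ 0#
  Σᶠ-inv = trans (Σᶠ-cong (λ x → sym (*-identityʳ (inv x)))) (Σᶠ-inv-power (s≤s z<s))

  Σᶠ-inv² : Σᶠ (λ x → inv x * inv x) ≈ 0#
  Σᶠ-inv² = trans (Σᶠ-cong (λ x → *-congˡ (sym (*-identityʳ (inv x))))) (Σᶠ-inv-power (s≤s (s≤s z<s)))

  -- Here 3 < q - 1 is used, that is q ≥ 5.
  Σᶠ-inv³ : Σᶠ (λ x → inv x * (inv x * inv x)) ≈ 0#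
  Σᶠ-inv³ = trans (Σᶠ-cong (λ x → *-congˡ (*-congˡ (sym (*-identityʳ (inv x)))))) (Σᶠ-inv-power (s≤s (s≤s (s≤s z<s))))

  Σᶠ-lin : ∀ a f g → Σᶠ (λ x → a * f x + g x) ≈ a * Σᶠ f + Σᶠ g
  Σᶠ-lin a f g = trans (Σᶠ-+ (λ x → a * f x) g) (+-congʳ (Σᶠ-*ˡ a f))

  -- The function defined by the polynomial t

  δ-cong : ∀ a → Congruent₁ _≈_ (δ a)
  δ-cong a {x} {y} x≈y with a ≟ x | a ≟ y
  ... | yes _   | yes _   = refl
  ... | yes a≈x | no a≉y  = contradiction (trans a≈x x≈y) a≉y
  ... | no a≉x  | yes a≈y = contradiction (trans a≈y (sym x≈y)) a≉x
  ... | no _    | no _    = refl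

  τ : Carrier → Carrier
  τ y = y + (δ 0# y - δ 1# y)

  τ-cong : Congruent₁ _≈_ τ
  τ-cong x≈y = +-cong x≈y (+-cong (δ-cong 0# x≈y) (-‿cong (δ-cong 1# x≈y)))

  τ-0 : ∀ {y} → y ≈ 0# → τ y ≈ 1#
  τ-0 {y} y≈0 = trans (+-cong y≈0 (+-cong (δ-≈ (sym y≈0)) (-‿cong (δ-≉ λ 1≈y → 0≉1 (sym (trans 1≈y y≈0))))))
    (solve 0 (con 0ℤ :+ (con 1ℤ :- con 0ℤ) := con 1ℤ) refl)

  τ-1 : ∀ {y} → y ≈ 1# → τ y ≈ 0#
  τ-1 {y} y≈1 = trans (+-cong y≈1 (+-cong (δ-≉ λ 0≈y → 0≉1 (trans 0≈y y≈1)) (-‿cong (δ-≈ (sym y≈1)))))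
    (solve 0 (con 1ℤ :+ (con 0ℤ :- con 1ℤ) := con 0ℤ) refl)

  τ-fixed : ∀ {y} → ¬ y ≈ 0# → ¬ y ≈ 1# → τ y ≈ y
  τ-fixed {y} y≉0 y≉1 = trans (+-congˡ (+-cong (δ-≉ (y≉0 ∘ sym)) (-‿cong (δ-≉ (y≉1 ∘ sym)))))
    (solve 1 (λ y → y :+ (con 0ℤ :- con 0ℤ) := y) refl y)

  -- `upTo` is `applyUpTo` at the identity, and unfolding `applyUpTo` shifts its function; an
  -- arbitrary f lets the inductions on k go through.
  powers : (ℕ → ℕ) → ℕ → Poly 1
  powers f k = ∑ (map (X 0F ^^_) (applyUpTo f k))

  eval-powers-suc : ∀ y f k → eval (y ∷ []) (powers f (suc k)) ≈ y ^ f 0 + eval (y ∷ []) (powers (f ∘ suc) k)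
  eval-powers-suc y f k = trans (linear-++ (mono (y ∷ [])) (X 0F ^^ f 0) (powers (f ∘ suc) k))
    (+-congʳ (trans (eval-^^ (y ∷ []) (X 0F) (f 0)) (^-congˡ (f 0) (eval-X (y ∷ []) 0F))))

  geometric : ∀ y f → (∀ i → f (suc i) ≡ suc (f i)) → ∀ k →
    (y - 1#) * eval (y ∷ []) (powers f k) ≈ y ^ f k - y ^ f 0
  geometric y f f-suc zero    = trans (zeroʳ _) (sym (-‿inverseʳ _))
  geometric y f f-suc (suc k) = begin
    (y - 1#) * eval (y ∷ []) (powers f (suc k))
      ≈⟨ *-congˡ (eval-powers-suc y f k) ⟩
    (y - 1#) * (y ^ f 0 + eval (y ∷ []) (powers (f ∘ suc) k))
      ≈⟨ distribˡ _ _ _ ⟩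
    (y - 1#) * y ^ f 0 + (y - 1#) * eval (y ∷ []) (powers (f ∘ suc) k)
      ≈⟨ +-congˡ (geometric y (f ∘ suc) (f-suc ∘ suc) k) ⟩
    (y - 1#) * y ^ f 0 + (y ^ f (suc k) - y ^ f 1)
      ≡⟨ ≡.cong (λ j → (y - 1#) * y ^ f 0 + (y ^ f (suc k) - y ^ j)) (f-suc 0) ⟩
    (y - 1#) * y ^ f 0 + (y ^ f (suc k) - y * y ^ f 0)
      ≈⟨ solve 3 (λ y a b → (y :- con 1ℤ) :* a :+ (b :- y :* a) := b :- a) refl y (y ^ f 0) (y ^ f (suc k)) ⟩
    y ^ f (suc k) - y ^ f 0 ∎

  1^ : ∀ {y} → y ≈ 1# → ∀ k → y ^ k ≈ 1#
  1^ y≈1 zero    = refl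
  1^ y≈1 (suc k) = trans (*-cong y≈1 (1^ y≈1 k)) (*-identityˡ 1#)

  geometric-1 : ∀ {y} → y ≈ 1# → ∀ f k → eval (y ∷ []) (powers f k) ≈ k ᴺ× 1#
  geometric-1 y≈1 f zero    = refl
  geometric-1 y≈1 f (suc k) = trans (eval-powers-suc _ f k) (+-cong (1^ y≈1 (f 0)) (geometric-1 y≈1 (f ∘ suc) k))

  -- The sum is (y^(q-1) - 1)/(y - 1) for y different from 1: it is 1 at y = 0 and 0 at the other
  -- units. At y = 1 it consists of q - 1 ones, which is -1.
  eval-powers : ∀ y → eval (y ∷ []) (powers (λ i → i) (suc n)) ≈ δ 0# y - δ 1# y
  eval-powers y with 0# ≟ y | 1# ≟ y
  ... | yes 0≈y | yes 1≈y = contradiction (trans 0≈y (sym 1≈y)) 0≉1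
  ... | yes 0≈y | no _    = begin
    S                          ≈⟨ solve 1 (λ s → s := :- ((con 0ℤ :- con 1ℤ) :* s)) refl S ⟩
    - ((0# - 1#) * S)          ≈⟨ -‿cong (*-congʳ (+-congʳ 0≈y)) ⟩
    - ((y - 1#) * S)           ≈⟨ -‿cong (geometric y (λ i → i) (λ _ → ≡.refl) (suc n)) ⟩
    - (y ^ suc n - 1#)         ≈⟨ -‿cong (+-congʳ (trans (*-congʳ (sym 0≈y)) (zeroˡ _))) ⟩
    - (0# - 1#)                ≈⟨ solve 0 (:- (con 0ℤ :- con 1ℤ) := con 1ℤ :- con 0ℤ) refl ⟩
    1# - 0#                    ∎
    where S = eval (y ∷ []) (powers (λ i → i) (suc n))
  ... | no _    | yes 1≈y = trans (geometric-1 (sym 1≈y) (λ i → i) (suc n))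
    (∙-cancelˡ 1# _ _ (trans q×1≈0 (solve 0 (con 0ℤ := con 1ℤ :+ (con 0ℤ :- con 1ℤ)) refl)))
  ... | no 0≉y  | no 1≉y  = trans (*-cancelˡ-0 (λ y-1≈0 → 1≉y (sym (x∙y⁻¹≈ε⇒x≈y y 1# y-1≈0)))
      (trans (geometric y (λ i → i) (λ _ → ≡.refl) (suc n))
        (trans (+-congʳ (fermat (0≉y ∘ sym))) (-‿inverseʳ 1#))))
    (sym (-‿inverseʳ 0#))

  eval-t : ∀ y → eval (y ∷ []) t ≈ τ y
  eval-t y = trans (linear-++ (mono (y ∷ [])) (X 0F) (powers (λ i → i) (suc n)))
    (+-cong (eval-X (y ∷ []) 0F) (eval-powers y))

  eval-t⟨⟩ : ∀ {k} (x : Vec Carrier k) P → eval x t⟨ P ⟩ ≈ τ (eval x P)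
  eval-t⟨⟩ x P = trans (eval-⟦⟧ x t (λ _ → P)) (eval-t (eval x P))

  f₃ : Poly 3
  f₃ = t⟨ f₂ ⊕ x₃ ^^ n ⟩

  eval-X^^ : ∀ {k} (x : Vec Carrier k) i → eval x (X i ^^ n) ≈ inv (lookup x i)
  eval-X^^ x i = trans (eval-^^ x (X i) n) (trans (^-congˡ n (eval-X x i)) (sym (inv-def (lookup x i))))

  eval-f₃ : ∀ a b c → eval (a ∷ b ∷ c ∷ []) f₃ ≈ τ (τ (inv a + inv b) + inv c)
  eval-f₃ a b c = trans (eval-t⟨⟩ x (f₂ ⊕ x₃ ^^ n)) (τ-cong (trans (linear-++ (mono x) f₂ (x₃ ^^ n)) (+-cong
    (trans (eval-t⟨⟩ x (x₁ ^^ n ⊕ x₂ ^^ n)) (τ-cong (trans (linear-++ (mono x) (x₁ ^^ n) (x₂ ^^ n)) (+-cong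
      (eval-X^^ x 0F) (eval-X^^ x 1F)))))
    (eval-X^^ x 2F))))
    where x = a ∷ b ∷ c ∷ []

  -- Moments of f₃

  -- The sum over the third variable. It sees the first two only through s = u + v.
  kernel : ℕ → Carrier → Carrier
  kernel k s = Σᶠ (λ w → τ (τ s + w) * inv w ^ k)

  kernel-cong : ∀ k → Congruent₁ _≈_ (kernel k)
  kernel-cong k s≈s′ = Σᶠ-cong λ w → *-congʳ (τ-cong (+-congʳ (τ-cong s≈s′)))

  moment : ℕ → ℕ → ℕ → Carrier
  moment i j k = Σᶠ λ u → Σᶠ λ v → kernel k (u + v) * (inv u ^ i * inv v ^ j)

  -- Writing x as `inv (inv x)` in the monomial makes the summand a function of the three inverses
  -- alone, and inversion permutes the field.
  Σᵛ-f₃ : ∀ i j k → Σᵛ 3 (λ x → eval x f₃ * mono x (i ∷ j ∷ k ∷ [])) ≈ moment i j k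
  Σᵛ-f₃ i j k = begin
    Σᵛ 3 (λ x → eval x f₃ * mono x (i ∷ j ∷ k ∷ []))
      ≈⟨ (Σᶠ-cong λ a → Σᶠ-cong λ b → Σᶠ-cong λ c → *-cong (eval-f₃ a b c)
           (*-cong (^-congˡ i (sym (inv-involutive a))) (*-cong (^-congˡ j (sym (inv-involutive b))) (*-congʳ (^-congˡ k (sym (inv-involutive c))))))) ⟩
    Σᶠ (λ a → Σᶠ λ b → Σᶠ λ c → G (inv a) (inv b) (inv c))
      ≈⟨ (Σᶠ-cong λ a → Σᶠ-cong λ b → Σᶠ-bijection (λ {w} {w′} → G-cong₃ {inv a} {inv b} {w} {w′}) inversion) ⟩
    Σᶠ (λ a → Σᶠ λ b → Σᶠ λ w → G (inv a) (inv b) w)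
      ≈⟨ (Σᶠ-cong λ a → Σᶠ-bijection (λ v≈v′ → Σᶠ-cong λ w → G-cong₂ {inv a} {w = w} v≈v′) inversion) ⟩
    Σᶠ (λ a → Σᶠ λ v → Σᶠ λ w → G (inv a) v w)
      ≈⟨ Σᶠ-bijection (λ u≈u′ → Σᶠ-cong λ v → Σᶠ-cong λ w → G-cong₁ {v = v} {w} u≈u′) inversion ⟩
    Σᶠ (λ u → Σᶠ λ v → Σᶠ λ w → G u v w)
      ≈⟨ (Σᶠ-cong λ u → Σᶠ-cong λ v → trans (Σᶠ-cong λ w → factor u v w) (Σᶠ-*ʳ (inv u ^ i * inv v ^ j) (λ w → τ (τ (u + v) + w) * inv w ^ k))) ⟩
    moment i j k ∎
    where
    G : Carrier → Carrier → Carrier → Carrier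
    G u v w = τ (τ (u + v) + w) * (inv u ^ i * (inv v ^ j * (inv w ^ k * 1#)))
    G-cong₁ : ∀ {u u′ v w} → u ≈ u′ → G u v w ≈ G u′ v w
    G-cong₁ eq = *-cong (τ-cong (+-congʳ (τ-cong (+-congʳ eq)))) (*-congʳ (^-congˡ i (inv-cong eq)))
    G-cong₂ : ∀ {u v v′ w} → v ≈ v′ → G u v w ≈ G u v′ w
    G-cong₂ eq = *-cong (τ-cong (+-congʳ (τ-cong (+-congˡ eq)))) (*-congˡ (*-congʳ (^-congˡ j (inv-cong eq))))
    G-cong₃ : ∀ {u v w w′} → w ≈ w′ → G u v w ≈ G u v w′
    G-cong₃ eq = *-cong (τ-cong (+-congˡ eq)) (*-congˡ (*-congˡ (*-congʳ (^-congˡ k (inv-cong eq)))))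
    factor : ∀ u v w → G u v w ≈ τ (τ (u + v) + w) * inv w ^ k * (inv u ^ i * inv v ^ j)
    factor u v w = solve 4 (λ t a b c → t :* (a :* (b :* (c :* con 1ℤ))) := t :* c :* (a :* b)) refl
      (τ (τ (u + v) + w)) (inv u ^ i) (inv v ^ j) (inv w ^ k)

  Σᶠ-τ : Σᶠ τ ≈ 0#
  Σᶠ-τ = begin
    Σᶠ τ                                                  ≈⟨ Σᶠ-+ (λ y → y) (λ y → δ 0# y - δ 1# y) ⟩
    Σᶠ (λ y → y) + Σᶠ (λ y → δ 0# y - δ 1# y)             ≈⟨ +-cong Σᶠ-id (Σᶠ-+ (δ 0#) (λ y → - δ 1# y)) ⟩
    0# + (Σᶠ (δ 0#) + Σᶠ (λ y → - δ 1# y))                ≈⟨ +-congˡ (+-cong (Σᶠ-δ-1 0#) (trans (Σᶠ-neg (δ 1#)) (-‿cong (Σᶠ-δ-1 1#)))) ⟩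
    0# + (1# - 1#)                                        ≈⟨ solve 0 (con 0ℤ :+ (con 1ℤ :- con 1ℤ) := con 0ℤ) refl ⟩
    0#                                                    ∎
    where
    Σᶠ-id : Σᶠ (λ y → y) ≈ 0#
    Σᶠ-id = trans (Σᶠ-cong (λ y → sym (*-identityʳ y))) (powerSum-small (s≤s z<s))

  kernel-0 : ∀ s → kernel 0 s ≈ 0#
  kernel-0 s = trans (Σᶠ-cong (λ w → *-identityʳ _)) (trans (Σᶠ-bijection τ-cong (translation (τ s))) Σᶠ-τ)

  moment-0₃ : ∀ i j → moment i j 0 ≈ 0#
  moment-0₃ i j = Σᶠ-zero λ u → Σᶠ-zero λ v → trans (*-congʳ (kernel-0 (u + v))) (zeroˡ _)

  -- Replacing v by v - u separates the double sum. The case i = 0 is included: the remaining factor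
  -- is then q · 1 = 0.
  moment-0₂ : ∀ {i} k → i ℕ.< suc n → moment i 0 k ≈ 0#
  moment-0₂ {i} k i< = begin
    moment i 0 k
      ≈⟨ (Σᶠ-cong λ u → trans (Σᶠ-*ʳ (inv u ^ i * 1#) (λ v → kernel k (u + v)))
           (*-cong (Σᶠ-bijection (kernel-cong k) (translation u)) (*-identityʳ _))) ⟩
    Σᶠ (λ u → Σᶠ (kernel k) * inv u ^ i)    ≈⟨ Σᶠ-*ˡ (Σᶠ (kernel k)) (λ u → inv u ^ i) ⟩
    Σᶠ (kernel k) * Σᶠ (λ u → inv u ^ i)    ≈⟨ *-congˡ (Σᶠ-inv-power i<) ⟩
    Σᶠ (kernel k) * 0#                      ≈⟨ zeroʳ _ ⟩
    0#                                      ∎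

  moment-0₁ : ∀ {j} k → j ℕ.< suc n → moment 0 j k ≈ 0#
  moment-0₁ {j} k j< = begin
    moment 0 j k   ≈⟨ Σᶠ-comm (λ u v → kernel k (u + v) * (1# * inv v ^ j)) ⟩
    Σᶠ (λ v → Σᶠ λ u → kernel k (u + v) * (1# * inv v ^ j))
      ≈⟨ (Σᶠ-cong λ v → Σᶠ-cong λ u → *-cong (kernel-cong k (+-comm u v)) (*-comm _ _)) ⟩
    moment j 0 k   ≈⟨ moment-0₂ k j< ⟩
    0#             ∎

  kernel₁ : Carrier → Carrier
  kernel₁ s = - 1# - inv s + inv (- 1# + s)

  kernel₁-cong : Congruent₁ _≈_ kernel₁
  kernel₁-cong eq = +-cong (+-congˡ (-‿cong (inv-cong eq))) (inv-cong (+-congˡ eq))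

  -- Both values are -2: at each point one of the two inverses is `inv` of 0 and drops out, and the
  -- other contributes -1.
  kernel₁-0-1 : kernel₁ 0# ≈ kernel₁ 1#
  kernel₁-0-1 = begin
    - 1# - inv 0# + inv (- 1# + 0#)    ≈⟨ +-cong (+-congˡ (-‿cong (inv-0 refl))) (trans (inv-cong (+-identityʳ _)) (trans (inv-neg 1#) (-‿cong inv-1))) ⟩
    - 1# - 0# - 1#                     ≈⟨ solve 0 (:- con 1ℤ :- con 0ℤ :- con 1ℤ := :- con 1ℤ :- con 1ℤ :+ con 0ℤ) refl ⟩
    - 1# - 1# + 0#                     ≈⟨ +-cong (+-congˡ (-‿cong inv-1)) (inv-0 (-‿inverseˡ 1#)) ⟨
    - 1# - inv 1# + inv (- 1# + 1#)    ∎

  -- τ drops out because kernel₁ takes the same value at 0 and 1.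
  kernel₁-τ : ∀ s → kernel₁ (τ s) ≈ kernel₁ s
  kernel₁-τ s with s ≟ 0# | s ≟ 1#
  ... | yes s≈0 | _       = trans (kernel₁-cong (τ-0 s≈0)) (trans (sym kernel₁-0-1) (kernel₁-cong (sym s≈0)))
  ... | no _    | yes s≈1 = trans (kernel₁-cong (τ-1 s≈1)) (trans kernel₁-0-1 (kernel₁-cong (sym s≈1)))
  ... | no s≉0  | no s≉1  = kernel₁-cong (τ-fixed s≉0 s≉1)

  δ-translate : ∀ a b x → δ a (b + x) ≈ δ (- b + a) x
  δ-translate a b x with a ≟ b + x | - b + a ≟ x
  ... | yes _ | yes _ = refl
  ... | yes a≈b+x | no ≉ = contradiction (trans (+-congˡ a≈b+x) (solve 2 (λ b x → :- b :+ (b :+ x) := x) refl b x)) ≉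
  ... | no ≉ | yes -b+a≈x = contradiction (trans (solve 2 (λ a b → a := b :+ (:- b :+ a)) refl a b) (+-congˡ -b+a≈x)) ≉
  ... | no _ | no _ = refl

  -- With S = `τ s`, the summand τ(S + w)/w has four parts: S/w sums to 0, w/w sums to -1, and the
  -- two `δ` terms of `τ` pick out w = -S and w = 1 - S.
  kernel-1 : ∀ s → kernel 1 s ≈ kernel₁ s
  kernel-1 s = trans (begin
    kernel 1 s
      ≈⟨ Σᶠ-cong (λ w → trans (expand (δ 0# (S + w)) (δ 1# (S + w)) w)
           (+-congˡ (+-cong (x*inv-x w) (+-cong (*-congʳ (δ-translate 0# S w)) (-‿cong (*-congʳ (δ-translate 1# S w))))))) ⟩
    Σᶠ (λ w → S * inv w + (1# - δ 0# w + (δ (- S + 0#) w * inv w - δ (- S + 1#) w * inv w)))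
      ≈⟨ Σᶠ-lin S inv (λ w → 1# - δ 0# w + (δ (- S + 0#) w * inv w - δ (- S + 1#) w * inv w)) ⟩
    S * Σᶠ inv + Σᶠ (λ w → 1# - δ 0# w + (δ (- S + 0#) w * inv w - δ (- S + 1#) w * inv w))
      ≈⟨ +-cong (*-congˡ Σᶠ-inv) (Σᶠ-+ (λ w → 1# - δ 0# w) (λ w → δ (- S + 0#) w * inv w - δ (- S + 1#) w * inv w)) ⟩
    S * 0# + (Σᶠ (λ w → 1# - δ 0# w) + Σᶠ (λ w → δ (- S + 0#) w * inv w - δ (- S + 1#) w * inv w))
      ≈⟨ +-congˡ (+-cong (trans (Σᶠ-cong (λ w → sym (power-q-1 w))) powerSum-q-1)
           (trans (Σᶠ-+ (λ w → δ (- S + 0#) w * inv w) (λ w → - (δ (- S + 1#) w * inv w)))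
             (+-cong (Σᶠ-δ inv-cong (- S + 0#)) (trans (Σᶠ-neg (λ w → δ (- S + 1#) w * inv w)) (-‿cong (Σᶠ-δ inv-cong (- S + 1#))))))) ⟩
    S * 0# + (- 1# + (inv (- S + 0#) - inv (- S + 1#)))
      ≈⟨ +-congˡ (+-congˡ (+-cong (trans (inv-cong (+-identityʳ (- S))) (inv-neg S))
           (-‿cong (trans (inv-cong (solve 1 (λ s → :- s :+ con 1ℤ := :- (:- con 1ℤ :+ s)) refl S)) (inv-neg (- 1# + S)))))) ⟩
    S * 0# + (- 1# + (- inv S - - inv (- 1# + S)))
      ≈⟨ solve 3 (λ s a b → s :* con 0ℤ :+ (:- con 1ℤ :+ (:- a :- :- b)) := :- con 1ℤ :- a :+ b) refl S (inv S) (inv (- 1# + S)) ⟩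
    kernel₁ S ∎) (kernel₁-τ s)
    where
    S = τ s
    expand : ∀ a b w → (S + w + (a - b)) * (inv w * 1#) ≈ S * inv w + (w * inv w + (a * inv w - b * inv w))
    expand a b w = solve 5 (λ s w a b i → (s :+ w :+ (a :- b)) :* (i :* con 1ℤ) := s :* i :+ (w :* i :+ (a :* i :- b :* i))) refl S w a b (inv w)

  -- For s nonzero, (1/s)(1/u + 1/(s-u)) sums to 0 over u, but at u = 0 and u = s it gives 1/s²
  -- where the product is 0; the two corrections make up the result. For s = 0 the sum is -Σ 1/u² =
  -- 0, which fits `inv s` = 0.
  convolution : ∀ s → Σᶠ (λ u → inv u * inv (- u + s)) ≈ - (1# + 1#) * (inv s * inv s)
  convolution s with s ≟ 0#
  ... | yes s≈0 = begin
    Σᶠ (λ u → inv u * inv (- u + s))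
      ≈⟨ Σᶠ-cong (λ u → trans (*-congˡ (trans (inv-cong (trans (+-congˡ s≈0) (+-identityʳ _))) (inv-neg u)))
           (solve 1 (λ i → i :* :- i := :- (i :* i)) refl (inv u))) ⟩
    Σᶠ (λ u → - (inv u * inv u))      ≈⟨ Σᶠ-neg (λ u → inv u * inv u) ⟩
    - Σᶠ (λ u → inv u * inv u)        ≈⟨ -‿cong Σᶠ-inv² ⟩
    - 0#                              ≈⟨ solve 0 (:- con 0ℤ := :- (con 1ℤ :+ con 1ℤ) :* (con 0ℤ :* con 0ℤ)) refl ⟩
    - (1# + 1#) * (0# * 0#)           ≈⟨ *-congˡ (*-cong (inv-0 s≈0) (inv-0 s≈0)) ⟨
    - (1# + 1#) * (inv s * inv s)     ∎
  ... | no s≉0  = begin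
    Σᶠ (λ u → inv u * inv (- u + s))
      ≈⟨ Σᶠ-cong pointwise ⟩
    Σᶠ (λ u → inv s * inv u + (inv s * inv (- u + s) + (- s⁻² * δ 0# u + - s⁻² * δ s u)))
      ≈⟨ Σᶠ-lin (inv s) inv _ ⟩
    inv s * Σᶠ inv + Σᶠ (λ u → inv s * inv (- u + s) + (- s⁻² * δ 0# u + - s⁻² * δ s u))
      ≈⟨ +-congˡ (Σᶠ-lin (inv s) (λ u → inv (- u + s)) _) ⟩
    inv s * Σᶠ inv + (inv s * Σᶠ (λ u → inv (- u + s)) + Σᶠ (λ u → - s⁻² * δ 0# u + - s⁻² * δ s u))
      ≈⟨ +-cong (*-congˡ Σᶠ-inv) (+-cong
           (*-congˡ (trans (Σᶠ-cong (λ u → inv-cong (+-comm (- u) s))) (trans (Σᶠ-bijection inv-cong (reflection s)) Σᶠ-inv)))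
           (trans (Σᶠ-lin (- s⁻²) (δ 0#) _) (+-cong (*-congˡ (Σᶠ-δ-1 0#)) (trans (Σᶠ-*ˡ (- s⁻²) (δ s)) (*-congˡ (Σᶠ-δ-1 s)))))) ⟩
    inv s * 0# + (inv s * 0# + (- s⁻² * 1# + - s⁻² * 1#))
      ≈⟨ solve 1 (λ i → i :* con 0ℤ :+ (i :* con 0ℤ :+ (:- (i :* i) :* con 1ℤ :+ :- (i :* i) :* con 1ℤ)) := :- (con 1ℤ :+ con 1ℤ) :* (i :* i)) refl (inv s) ⟩
    - (1# + 1#) * (inv s * inv s) ∎
    where
    s⁻² = inv s * inv s
    pointwise : ∀ u → inv u * inv (- u + s) ≈ inv s * inv u + (inv s * inv (- u + s) + (- s⁻² * δ 0# u + - s⁻² * δ s u))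
    pointwise u with 0# ≟ u | s ≟ u
    ... | yes 0≈u | yes s≈u = contradiction (trans s≈u (sym 0≈u)) s≉0
    ... | yes 0≈u | no _    = begin
      inv u * inv (- u + s)   ≈⟨ *-cong u⁻¹≈0 v⁻¹≈s⁻¹ ⟩
      0# * inv s
        ≈⟨ solve 1 (λ i → con 0ℤ :* i := i :* con 0ℤ :+ (i :* i :+ (:- (i :* i) :* con 1ℤ :+ :- (i :* i) :* con 0ℤ))) refl (inv s) ⟩
      inv s * 0# + (inv s * inv s + (- s⁻² * 1# + - s⁻² * 0#))
        ≈⟨ +-cong (*-congˡ u⁻¹≈0) (+-congʳ (*-congˡ v⁻¹≈s⁻¹)) ⟨
      inv s * inv u + (inv s * inv (- u + s) + (- s⁻² * 1# + - s⁻² * 0#)) ∎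
      where
      u⁻¹≈0 : inv u ≈ 0#
      u⁻¹≈0 = inv-0 (sym 0≈u)
      v⁻¹≈s⁻¹ : inv (- u + s) ≈ inv s
      v⁻¹≈s⁻¹ = inv-cong (trans (+-congʳ (-‿cong (sym 0≈u))) (solve 1 (λ s → :- con 0ℤ :+ s := s) refl s))
    ... | no _    | yes s≈u = begin
      inv u * inv (- u + s)   ≈⟨ *-cong u⁻¹≈s⁻¹ v⁻¹≈0 ⟩
      inv s * 0#
        ≈⟨ solve 1 (λ i → i :* con 0ℤ := i :* i :+ (i :* con 0ℤ :+ (:- (i :* i) :* con 0ℤ :+ :- (i :* i) :* con 1ℤ))) refl (inv s) ⟩
      inv s * inv s + (inv s * 0# + (- s⁻² * 0# + - s⁻² * 1#))
        ≈⟨ +-cong (*-congˡ u⁻¹≈s⁻¹) (+-congʳ (*-congˡ v⁻¹≈0)) ⟨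
      inv s * inv u + (inv s * inv (- u + s) + (- s⁻² * 0# + - s⁻² * 1#)) ∎
      where
      u⁻¹≈s⁻¹ : inv u ≈ inv s
      u⁻¹≈s⁻¹ = inv-cong (sym s≈u)
      v⁻¹≈0 : inv (- u + s) ≈ 0#
      v⁻¹≈0 = inv-0 (trans (+-congˡ s≈u) (-‿inverseˡ u))
    ... | no 0≉u  | no s≉u  = trans
      (inv-*-inv (0≉u ∘ sym) (λ v≈0 → s≉u (trans (solve 2 (λ u s → s := :- u :+ s :+ u) refl u s) (trans (+-congʳ v≈0) (+-identityˡ u)))) s≉0
        (solve 2 (λ u s → u :+ (:- u :+ s) := s) refl u s))
      (solve 3 (λ i a b → i :* (a :+ b) := i :* a :+ (i :* b :+ (:- (i :* i) :* con 0ℤ :+ :- (i :* i) :* con 0ℤ))) refl (inv s) (inv u) (inv (- u + s)))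

  inv²-inv : Carrier → Carrier
  inv²-inv s = inv s * inv s * inv (- 1# + s)

  -- Partial fractions 1/(s-1) - 1/s - 1/s². At s = 0 and s = 1 the left side is 0 while these give
  -- -1 and -2, hence the coefficients 1 and 2 of the `δ` terms. The factors `1#` fit the shape of
  -- `Σᶠ-lin`.
  inv²-inv-expand : ∀ s → inv²-inv s ≈
    1# * inv (- 1# + s) + (- 1# * inv s + (- 1# * (inv s * inv s) + (1# * δ 0# s + (1# + 1#) * δ 1# s)))
  inv²-inv-expand s with 0# ≟ s | 1# ≟ s
  ... | yes 0≈s | yes 1≈s = contradiction (trans 0≈s (sym 1≈s)) 0≉1
  ... | yes 0≈s | no _    = begin
    inv s * inv s * B        ≈⟨ *-congʳ (*-congʳ A≈0) ⟩
    0# * inv s * B           ≈⟨ solve 2 (λ a b → con 0ℤ :* a :* b := con 1ℤ :* :- con 1ℤ :+ (:- con 1ℤ :* con 0ℤ :+ (:- con 1ℤ :* (con 0ℤ :* con 0ℤ) :+ (con 1ℤ :* con 1ℤ :+ (con 1ℤ :+ con 1ℤ) :* con 0ℤ)))) refl (inv s) B ⟩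
    1# * - 1# + (- 1# * 0# + (- 1# * (0# * 0#) + (1# * 1# + (1# + 1#) * 0#)))
      ≈⟨ +-cong (*-congˡ B≈-1) (+-cong (*-congˡ A≈0) (+-congʳ (*-congˡ (*-cong A≈0 A≈0)))) ⟨
    1# * B + (- 1# * inv s + (- 1# * (inv s * inv s) + (1# * 1# + (1# + 1#) * 0#))) ∎
    where
    B = inv (- 1# + s)
    A≈0 : inv s ≈ 0#
    A≈0 = inv-0 (sym 0≈s)
    B≈-1 : B ≈ - 1#
    B≈-1 = trans (inv-cong (trans (+-congˡ (sym 0≈s)) (+-identityʳ _))) (trans (inv-neg 1#) (-‿cong inv-1))
  ... | no _    | yes 1≈s = begin
    inv s * inv s * B        ≈⟨ *-congˡ B≈0 ⟩
    inv s * inv s * 0#       ≈⟨ solve 1 (λ a → a :* a :* con 0ℤ := con 1ℤ :* con 0ℤ :+ (:- con 1ℤ :* con 1ℤ :+ (:- con 1ℤ :* (con 1ℤ :* con 1ℤ) :+ (con 1ℤ :* con 0ℤ :+ (con 1ℤ :+ con 1ℤ) :* con 1ℤ)))) refl (inv s) ⟩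
    1# * 0# + (- 1# * 1# + (- 1# * (1# * 1#) + (1# * 0# + (1# + 1#) * 1#)))
      ≈⟨ +-cong (*-congˡ B≈0) (+-cong (*-congˡ A≈1) (+-congʳ (*-congˡ (*-cong A≈1 A≈1)))) ⟨
    1# * B + (- 1# * inv s + (- 1# * (inv s * inv s) + (1# * 0# + (1# + 1#) * 1#))) ∎
    where
    B = inv (- 1# + s)
    A≈1 : inv s ≈ 1#
    A≈1 = trans (inv-cong (sym 1≈s)) inv-1
    B≈0 : B ≈ 0#
    B≈0 = inv-0 (trans (+-congˡ (sym 1≈s)) (-‿inverseˡ 1#))
  ... | no 0≉s  | no 1≉s  = begin
    A * A * B                      ≈⟨ *-assoc A A B ⟩
    A * (A * B)                    ≈⟨ *-congˡ AB≈B-A ⟩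
    A * (B - A)                    ≈⟨ solve 2 (λ a b → a :* (b :- a) := a :* b :- a :* a) refl A B ⟩
    A * B - A * A                  ≈⟨ +-congʳ AB≈B-A ⟩
    B - A - A * A                  ≈⟨ solve 2 (λ a b → b :- a :- a :* a := con 1ℤ :* b :+ (:- con 1ℤ :* a :+ (:- con 1ℤ :* (a :* a) :+ (con 1ℤ :* con 0ℤ :+ (con 1ℤ :+ con 1ℤ) :* con 0ℤ)))) refl A B ⟩
    1# * B + (- 1# * A + (- 1# * (A * A) + (1# * 0# + (1# + 1#) * 0#))) ∎
    where
    A = inv s
    B = inv (- 1# + s)
    1-s≉0 : ¬ - (- 1# + s) ≈ 0#
    1-s≉0 eq = 1≉s (trans (solve 1 (λ s → con 1ℤ := :- (:- con 1ℤ :+ s) :+ s) refl s) (trans (+-congʳ eq) (+-identityˡ s)))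
    -- Partial fractions for s + (1 - s) = 1; the sign is due to `B` inverting s - 1 instead of 1 -
    -- s.
    AB≈B-A : A * B ≈ B - A
    AB≈B-A = begin
      A * B                            ≈⟨ solve 2 (λ a b → a :* b := :- (a :* :- b)) refl A B ⟩
      - (A * - B)                      ≈⟨ -‿cong (*-congˡ (inv-neg (- 1# + s))) ⟨
      - (A * inv (- (- 1# + s)))       ≈⟨ -‿cong (inv-*-inv (0≉s ∘ sym) 1-s≉0 (0≉1 ∘ sym) (solve 1 (λ s → s :+ :- (:- con 1ℤ :+ s) := con 1ℤ) refl s)) ⟩
      - (inv 1# * (A + inv (- (- 1# + s))))    ≈⟨ -‿cong (*-cong inv-1 (+-congˡ (inv-neg (- 1# + s)))) ⟩
      - (1# * (A + - B))               ≈⟨ solve 2 (λ a b → :- (con 1ℤ :* (a :+ :- b)) := b :- a) refl A B ⟩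
      B - A                            ∎

  Σᶠ-inv²-inv : Σᶠ inv²-inv ≈ 1# + (1# + 1#)
  Σᶠ-inv²-inv = begin
    Σᶠ inv²-inv
      ≈⟨ Σᶠ-cong inv²-inv-expand ⟩
    Σᶠ (λ s → 1# * inv (- 1# + s) + (- 1# * inv s + (- 1# * (inv s * inv s) + (1# * δ 0# s + (1# + 1#) * δ 1# s))))
      ≈⟨ Σᶠ-lin 1# (λ s → inv (- 1# + s)) _ ⟩
    1# * Σᶠ (λ s → inv (- 1# + s)) + Σᶠ (λ s → - 1# * inv s + (- 1# * (inv s * inv s) + (1# * δ 0# s + (1# + 1#) * δ 1# s)))
      ≈⟨ +-cong (*-congˡ (trans (Σᶠ-bijection inv-cong (translation (- 1#))) Σᶠ-inv)) (Σᶠ-lin (- 1#) inv _) ⟩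
    1# * 0# + (- 1# * Σᶠ inv + Σᶠ (λ s → - 1# * (inv s * inv s) + (1# * δ 0# s + (1# + 1#) * δ 1# s)))
      ≈⟨ +-congˡ (+-cong (*-congˡ Σᶠ-inv) (Σᶠ-lin (- 1#) (λ s → inv s * inv s) _)) ⟩
    1# * 0# + (- 1# * 0# + (- 1# * Σᶠ (λ s → inv s * inv s) + Σᶠ (λ s → 1# * δ 0# s + (1# + 1#) * δ 1# s)))
      ≈⟨ +-congˡ (+-congˡ (+-cong (*-congˡ Σᶠ-inv²)
           (trans (Σᶠ-lin 1# (δ 0#) _) (+-cong (*-congˡ (Σᶠ-δ-1 0#)) (trans (Σᶠ-*ˡ (1# + 1#) (δ 1#)) (*-congˡ (Σᶠ-δ-1 1#))))))) ⟩
    1# * 0# + (- 1# * 0# + (- 1# * 0# + (1# * 1# + (1# + 1#) * 1#)))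
      ≈⟨ solve 0 (con 1ℤ :* con 0ℤ :+ (:- con 1ℤ :* con 0ℤ :+ (:- con 1ℤ :* con 0ℤ :+ (con 1ℤ :* con 1ℤ :+ (con 1ℤ :+ con 1ℤ) :* con 1ℤ))) := con 1ℤ :+ (con 1ℤ :+ con 1ℤ)) refl ⟩
    1# + (1# + 1#) ∎

  moment-111 : moment 1 1 1 ≈ - (6 ᴺ× 1#)
  moment-111 = begin
    moment 1 1 1
      ≈⟨ (Σᶠ-cong λ u → Σᶠ-cong λ v → *-cong (kernel-1 (u + v)) (*-cong (*-identityʳ (inv u)) (*-identityʳ (inv v)))) ⟩
    Σᶠ (λ u → Σᶠ λ v → kernel₁ (u + v) * (inv u * inv v))
      -- Substitution v = s - u, after which the kernel no longer involves u.
      ≈⟨ (Σᶠ-cong λ u → sym (Σᶠ-bijection (λ eq → *-cong (kernel₁-cong (+-congˡ eq)) (*-congˡ (inv-cong eq))) (translation (- u)))) ⟩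
    Σᶠ (λ u → Σᶠ λ s → kernel₁ (u + (- u + s)) * (inv u * inv (- u + s)))
      ≈⟨ (Σᶠ-cong λ u → Σᶠ-cong λ s → *-congʳ (kernel₁-cong (solve 2 (λ u s → u :+ (:- u :+ s) := s) refl u s))) ⟩
    Σᶠ (λ u → Σᶠ λ s → kernel₁ s * (inv u * inv (- u + s)))
      ≈⟨ Σᶠ-comm (λ u s → kernel₁ s * (inv u * inv (- u + s))) ⟩
    Σᶠ (λ s → Σᶠ λ u → kernel₁ s * (inv u * inv (- u + s)))
      ≈⟨ (Σᶠ-cong λ s → trans (Σᶠ-*ˡ (kernel₁ s) (λ u → inv u * inv (- u + s))) (*-congˡ (convolution s))) ⟩
    Σᶠ (λ s → kernel₁ s * (- (1# + 1#) * (inv s * inv s)))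
      -- The product is 2/s² + 2/s³ - 2/(s²(s-1)), of which only the last term has a nonvanishing
      -- sum in general.
      ≈⟨ Σᶠ-cong (λ s → solve 2 (λ a b → (:- con 1ℤ :- a :+ b) :* (:- (con 1ℤ :+ con 1ℤ) :* (a :* a))
           := (con 1ℤ :+ con 1ℤ) :* (a :* a) :+ ((con 1ℤ :+ con 1ℤ) :* (a :* (a :* a)) :+ :- (con 1ℤ :+ con 1ℤ) :* (a :* a :* b)))
           refl (inv s) (inv (- 1# + s))) ⟩
    Σᶠ (λ s → (1# + 1#) * (inv s * inv s) + ((1# + 1#) * (inv s * (inv s * inv s)) + - (1# + 1#) * inv²-inv s))
      ≈⟨ Σᶠ-lin (1# + 1#) (λ s → inv s * inv s) _ ⟩
    (1# + 1#) * Σᶠ (λ s → inv s * inv s) + Σᶠ (λ s → (1# + 1#) * (inv s * (inv s * inv s)) + - (1# + 1#) * inv²-inv s)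
      ≈⟨ +-cong (*-congˡ Σᶠ-inv²) (trans (Σᶠ-lin (1# + 1#) (λ s → inv s * (inv s * inv s)) _)
           (+-cong (*-congˡ Σᶠ-inv³) (trans (Σᶠ-*ˡ (- (1# + 1#)) inv²-inv) (*-congˡ Σᶠ-inv²-inv)))) ⟩
    (1# + 1#) * 0# + ((1# + 1#) * 0# + - (1# + 1#) * (1# + (1# + 1#)))
      -- The right side spells out how `6 ᴺ× 1#` unfolds, including the final `0#`.
      ≈⟨ solve 0 ((con 1ℤ :+ con 1ℤ) :* con 0ℤ :+ ((con 1ℤ :+ con 1ℤ) :* con 0ℤ :+ :- (con 1ℤ :+ con 1ℤ) :* (con 1ℤ :+ (con 1ℤ :+ con 1ℤ)))
           := :- (con 1ℤ :+ (con 1ℤ :+ (con 1ℤ :+ (con 1ℤ :+ (con 1ℤ :+ (con 1ℤ :+ con 0ℤ))))))) refl ⟩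
    - (6 ᴺ× 1#) ∎

open import Data.Nat.Base using (_*_; _∸_; _^_)

-- Divisibility of prime powers and sums of complementary exponents.

module Arithmetic where

  prime∣^⇒≡ : ∀ {a p} → Prime a → Prime p → ∀ r → a ∣ p ^ r → a ≡ p
  prime∣^⇒≡ {a} a-prime p-prime zero    a∣1 = contradiction a-prime (≡.subst (¬_ ∘ Prime) (≡.sym (∣1⇒≡1 a∣1)) (from-no (prime? 1)))
  prime∣^⇒≡ {a} {p} a-prime p-prime (suc r) a∣p^ with euclidsLemma p (p ^ r) a-prime a∣p^
  ... | inj₂ a∣p^r = prime∣^⇒≡ a-prime p-prime r a∣p^r
  ... | inj₁ a∣p with prime⇒irreducible p-prime a∣p
  ...   | inj₂ a≡p    = a≡p
  ...   | inj₁ ≡.refl = contradiction a-prime (from-no (prime? 1))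

  coprime-6 : ∀ {k} → ¬ 2 ∣ k → ¬ 3 ∣ k → Coprime k 6
  coprime-6 2∤k 3∤k {d} (d∣k , d∣6) = go d d∣k d∣6 (∣⇒≤ d∣6)
    where
    go : ∀ d → d ∣ _ → d ∣ 6 → d ℕ.≤ 6 → d ≡ 1
    go 0 _   0∣6 _ = contradiction 0∣6 (from-no (0 ∣? 6))
    go 1 _   _   _ = ≡.refl
    go 2 2∣k _   _ = contradiction 2∣k 2∤k
    go 3 3∣k _   _ = contradiction 3∣k 3∤k
    go 4 _   4∣6 _ = contradiction 4∣6 (from-no (4 ∣? 6))
    go 5 _   5∣6 _ = contradiction 5∣6 (from-no (5 ∣? 6))
    go 6 6∣k _   _ = contradiction (∣-trans (divides 3 ≡.refl) 6∣k) 2∤k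
    go (suc (suc (suc (suc (suc (suc (suc _))))))) _ _ (s≤s (s≤s (s≤s (s≤s (s≤s (s≤s ()))))))

  -- The two degrees add up to 3(q-1) = 3n + 3.
  sum-complement : ∀ n (e d : Vec ℕ 3) → (∀ i → lookup e i ℕ.+ lookup d i ≡ suc n) → 3 * n ℕ.< Vec.sum e → Vec.sum d ℕ.< 3
  sum-complement n e@(e₁ ∷ e₂ ∷ e₃ ∷ []) d@(d₁ ∷ d₂ ∷ d₃ ∷ []) eq 3n< =
    ℕₚ.+-cancelˡ-< (3 * n) (Vec.sum d) 3 (ℕₚ.<-≤-trans (ℕₚ.+-monoˡ-< (Vec.sum d) 3n<) (ℕₚ.≤-reflexive total))
    where
    total : Vec.sum e ℕ.+ Vec.sum d ≡ 3 * n ℕ.+ 3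
    total = begin
      Vec.sum e ℕ.+ Vec.sum d
        ≡⟨ solve 6 (λ a b c x y z → a :+ (b :+ (c :+ con 0)) :+ (x :+ (y :+ (z :+ con 0))) := a :+ x :+ (b :+ y) :+ (c :+ z)) ≡.refl e₁ e₂ e₃ d₁ d₂ d₃ ⟩
      e₁ ℕ.+ d₁ ℕ.+ (e₂ ℕ.+ d₂) ℕ.+ (e₃ ℕ.+ d₃)
        ≡⟨ ≡.cong₂ ℕ._+_ (≡.cong₂ ℕ._+_ (eq 0F) (eq 1F)) (eq 2F) ⟩
      suc n ℕ.+ suc n ℕ.+ suc n
        ≡⟨ solve 1 (λ n → con 1 :+ n :+ (con 1 :+ n) :+ (con 1 :+ n) := n :+ (n :+ (n :+ con 0)) :+ con 3) ≡.refl n ⟩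
      3 * n ℕ.+ 3 ∎
      where
      open ≡.≡-Reasoning
      open +-*-Solver

  lookup≤sum : ∀ {k} (d : Vec ℕ k) i → lookup d i ℕ.≤ Vec.sum d
  lookup≤sum (k ∷ d) zero    = ℕₚ.m≤m+n k _
  lookup≤sum (k ∷ d) (suc i) = ℕₚ.≤-trans (lookup≤sum d i) (ℕₚ.m≤n+m _ k)

-- The degree of the reduced representative.

module ReducedDegree {c ℓ : Level} {m : ℕ} (F : FiniteField c ℓ (5 ℕ.+ m)) (coprime : Coprime (5 ℕ.+ m) 6) where
  open FiniteField F hiding (zero; _*_)
  open FiniteField F using () renaming (_*_ to _·_)
  open FiniteFieldTheory F
  open Transposition F
  open PolynomialTheory commutativeRing
  open CoefficientExtraction F
  open Moments F
  open Arithmetic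
  open IntegerCoefficients commutativeRing using (solve; _:=_; _:*_; :-_; con)
  open import Algebra.Properties.Semiring.Exp semiring using () renaming (_^_ to _^ᶠ_)
  open import Algebra.Properties.Semiring.Mult semiring using (×1-homo-*) renaming (_×_ to _ᴺ×_)
  open import Relation.Binary.Reasoning.Setoid setoid

  ᴺ×-multiple : ∀ k {j} → j ᴺ× 1# ≈ 0# → (k * j) ᴺ× 1# ≈ 0#
  ᴺ×-multiple k {j} j≈0 = trans (×1-homo-* k j) (trans (*-congˡ j≈0) (zeroʳ _))

  ᴺ×-Bézout : ∀ {i j} x y → i ᴺ× 1# ≈ 0# → j ᴺ× 1# ≈ 0# → 1 ℕ.+ y * j ≢ x * i
  ᴺ×-Bézout {i} {j} x y i≈0 j≈0 eq = 0≉1 (begin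
    0#                          ≈⟨ ᴺ×-multiple x i≈0 ⟨
    (x * i) ᴺ× 1#               ≡⟨ ≡.cong (_ᴺ× 1#) eq ⟨
    1# + (y * j) ᴺ× 1#          ≈⟨ +-congˡ (ᴺ×-multiple y j≈0) ⟩
    1# + 0#                     ≈⟨ +-identityʳ 1# ⟩
    1#                          ∎)

  -- The multiple q · 1 vanishes; if 6 · 1 did as well, a Bézout relation between q and 6 would give
  -- 1 = 0.
  6≉0 : ¬ 6 ᴺ× 1# ≈ 0#
  6≉0 6≈0 with coprime-Bézout coprime
  ... | Bézout.+- x y eq = ᴺ×-Bézout x y q×1≈0 6≈0 eq
  ... | Bézout.-+ x y eq = ᴺ×-Bézout y x 6≈0 q×1≈0 eq

  -- Three positive indices would sum to at least 3, so at least one of them is 0.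
  moment-small : ∀ i j k → i ℕ.+ (j ℕ.+ (k ℕ.+ 0)) ℕ.< 3 → (∀ l → lookup (i ∷ j ∷ k ∷ []) l ℕ.< suc n) → moment i j k ≈ 0#
  moment-small zero    j       k       _   d< = moment-0₁ k (d< 1F)
  moment-small (suc i) zero    k       _   d< = moment-0₂ k (d< 0F)
  moment-small (suc i) (suc j) zero    _   d< = moment-0₃ (suc i) (suc j)
  moment-small (suc i) (suc j) (suc k) d<3 d< = contradiction d<3 (ℕₚ.≤⇒≯
    (ℕₚ.+-mono-≤ (s≤s (z≤n {i})) (ℕₚ.+-mono-≤ (s≤s (z≤n {j})) (ℕₚ.+-mono-≤ (s≤s (z≤n {k})) (z≤n {0})))))

  module _ {R : Poly 3} (representative : IsReducedRepresentative q f₃ R) where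

    -- Every point of the field satisfies x^q = x, so `f₃` and `R` have the same values and moments;
    -- the sign is (-1)³, one factor per variable.
    moment-coeff : ∀ i j k e → (∀ l → lookup e l ℕ.+ lookup (i ∷ j ∷ k ∷ []) l ≡ suc n) →
      (∀ l → lookup (i ∷ j ∷ k ∷ []) l ℕ.< suc n) → moment i j k ≈ - coeff R e
    moment-coeff i j k e eq d< = begin
      moment i j k                                          ≈⟨ Σᵛ-f₃ i j k ⟨
      Σᵛ 3 (λ x → eval x f₃ · mono x (i ∷ j ∷ k ∷ []))
        ≈⟨ Σᵛ-cong 3 (λ x → *-congʳ {mono x (i ∷ j ∷ k ∷ [])} (eval-CongruentMod q x (x^q≈x ∘ lookup x) {f₃} {R} (proj₂ representative))) ⟩
      Σᵛ 3 (λ x → eval x R · mono x (i ∷ j ∷ k ∷ []))       ≈⟨ extract {P = R} (proj₁ representative) (i ∷ j ∷ k ∷ []) e eq d< ⟩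
      (- 1#) ^ᶠ 3 · coeff R e
        ≈⟨ solve 1 (λ x → :- con 1ℤ :* (:- con 1ℤ :* (:- con 1ℤ :* con 1ℤ)) :* x := :- x) refl (coeff R e) ⟩
      - coeff R e                                           ∎

    leading : ¬ coeff R (n ∷ n ∷ n ∷ []) ≈ 0#
    leading coeff≈0 = 6≉0 (begin
      6 ᴺ× 1#             ≈⟨ solve 1 (λ x → x := :- :- x) refl (6 ᴺ× 1#) ⟩
      - - (6 ᴺ× 1#)       ≈⟨ -‿cong moment-111 ⟨
      - moment 1 1 1      ≈⟨ -‿cong (moment-coeff 1 1 1 (n ∷ n ∷ n ∷ []) complement small) ⟩
      - - coeff R (n ∷ n ∷ n ∷ [])   ≈⟨ -‿cong (-‿cong coeff≈0) ⟩
      - - 0#              ≈⟨ solve 0 (:- :- con 0ℤ := con 0ℤ) refl ⟩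
      0#                  ∎)
      where
      complement : ∀ l → lookup (n ∷ n ∷ n ∷ []) l ℕ.+ lookup (1 ∷ 1 ∷ 1 ∷ []) l ≡ suc n
      complement 0F = ℕₚ.+-comm n 1
      complement 1F = ℕₚ.+-comm n 1
      complement 2F = ℕₚ.+-comm n 1
      small : ∀ l → lookup (1 ∷ 1 ∷ 1 ∷ []) l ℕ.< suc n
      small 0F = s≤s z<s
      small 1F = s≤s z<s
      small 2F = s≤s z<s

    coeff-large : ∀ e → 3 * n ℕ.< Vec.sum e → coeff R e ≈ 0#
    coeff-large e@(e₁ ∷ e₂ ∷ e₃ ∷ []) 3n<e with Finₚ.any? (λ i → q ℕₚ.≤? lookup e i)
    -- Exponents with an entry of at least q are excluded by reducedness; for the others the
    -- subtraction in the complement is exact.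
    ... | yes (i , q≤e) = proj₁ representative e i q≤e
    ... | no ¬large     = begin
      coeff R e           ≈⟨ solve 1 (λ x → x := :- :- x) refl (coeff R e) ⟩
      - - coeff R e       ≈⟨ -‿cong (moment-coeff (suc n ∸ e₁) (suc n ∸ e₂) (suc n ∸ e₃) e complement d<) ⟨
      - moment (suc n ∸ e₁) (suc n ∸ e₂) (suc n ∸ e₃)
        ≈⟨ -‿cong (moment-small (suc n ∸ e₁) (suc n ∸ e₂) (suc n ∸ e₃) Σd<3 d<) ⟩
      - 0#                ≈⟨ solve 0 (:- con 0ℤ := con 0ℤ) refl ⟩
      0#                  ∎
      where
      d : Vec ℕ 3
      d = suc n ∸ e₁ ∷ suc n ∸ e₂ ∷ suc n ∸ e₃ ∷ []
      e≤ : ∀ l → lookup e l ℕ.≤ suc n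
      e≤ l = ℕₚ.≤-pred (ℕₚ.≰⇒> λ q≤ → ¬large (l , q≤))
      complement : ∀ l → lookup e l ℕ.+ lookup d l ≡ suc n
      complement 0F = ℕₚ.m+[n∸m]≡n (e≤ 0F)
      complement 1F = ℕₚ.m+[n∸m]≡n (e≤ 1F)
      complement 2F = ℕₚ.m+[n∸m]≡n (e≤ 2F)
      Σd<3 : Vec.sum d ℕ.< 3
      Σd<3 = sum-complement n e d complement 3n<e
      d< : ∀ l → lookup d l ℕ.< suc n
      -- Each entry is at most the sum, hence less than 3, and 3 ≤ q - 1.
      d< l = ℕₚ.<-≤-trans (ℕₚ.≤-<-trans (lookup≤sum d l) Σd<3) (s≤s (s≤s (s≤s z≤n)))

  hasReducedDegree : HasReducedDegree q f₃ (3 * n)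
  hasReducedDegree = Reduction.reducedRepresentative n f₃ , λ R representative →
    (n ∷ n ∷ n ∷ [] , ≡.refl , leading representative) , coeff-large representative

open Arithmetic

mainTheorem15 : ∀ {c ℓ : Level} (p r q : ℕ) → Prime p → p ≢ 2 → p ≢ 3 → q ≡ p ^ r →
    (F : FiniteField c ℓ q) → let open Transposition F in
    HasReducedDegree q (t⟨ f₂ ⊕ x₃ ^^ (q ∸ 2) ⟩) (3 * (q ∸ 2))
mainTheorem15 p r q p-prime p≢2 p≢3 q≡p^r F = go q F
  (λ 2∣q → p≢2 (≡.sym (prime∣^⇒≡ (from-yes (prime? 2)) p-prime r (≡.subst (2 ∣_) q≡p^r 2∣q))))
  (λ 3∣q → p≢3 (≡.sym (prime∣^⇒≡ (from-yes (prime? 3)) p-prime r (≡.subst (3 ∣_) q≡p^r 3∣q))))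
  where
  go : ∀ {c ℓ : Level} q (F : FiniteField c ℓ q) → ¬ 2 ∣ q → ¬ 3 ∣ q → let open Transposition F in
    HasReducedDegree q (t⟨ f₂ ⊕ x₃ ^^ (q ∸ 2) ⟩) (3 * (q ∸ 2))
  go 0 F 2∤q 3∤q = contradiction (divides 0 ≡.refl) 2∤q
  -- The case r = 0: with a single element 0 and 1 would coincide.
  go 1 F 2∤q 3∤q = contradiction (trans (sym (strictlyInverseʳ 0#)) (trans (from-cong (unique (to 0#) (to 1#))) (strictlyInverseʳ 1#))) 0≉1
    where
    open FiniteField F
    open Inverse enumeration using (to; from-cong; strictlyInverseʳ)
    unique : (i j : Fin 1) → i ≡ j
    unique 0F 0F = ≡.refl
  go 2 F 2∤q 3∤q = contradiction (divides 1 ≡.refl) 2∤q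
  go 3 F 2∤q 3∤q = contradiction (divides 1 ≡.refl) 3∤q
  go 4 F 2∤q 3∤q = contradiction (divides 2 ≡.refl) 2∤q
  go (suc (suc (suc (suc (suc m))))) F 2∤q 3∤q = ReducedDegree.hasReducedDegree F (coprime-6 2∤q 3∤q)
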